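{- Let $K$ be the class of cotorsionfree abelian groups, let $\lambda=(2^{\aleph_0})^+$, let $\psi$ be a sentence of the infinitary language $L_{\lambda,\omega}$ (in the vocabulary $\{+,-,0\}$ of groups) such that $K=\mathrm{Mod}(\psi)$, and let $\mathbb{A}$ be a fragment of $L_{\lambda,\omega}$ containing $\psi$. For $G,H\in K$ define $G<_K H$ if and only if $G$ is an $L_{\mathbb{A}}$-elementary substructure of $H$. Then $(K,<_K)$ is an abstract elementary class, with Löwenheim–Skolem number $\mathrm{LS}(K)=|\mathbb{A}|$.
   Context: A group $G$ is cotorsion if $\mathrm{Ext}(J,G)=0$ for every torsionfree abelian group $J$; it is cotorsionfree if it has no nonzero cotorsion subgroup (equivalently, no subgroup isomorphic to $\mathbb{Q}$, $\mathbb{Z}/p\mathbb{Z}$ or the $p$-adic integers $J_p$, $p$ prime). It is a known theorem (Kolman–Shelah) that a sentence $\psi$ of $L_{\lambda,\omega}$, $\lambda=(2^{\aleph_0})^+$, with $K=\mathrm{Mod}(\psi)$ exists. $L_{\lambda,\omega}$ allows conjunctions and disjunctions of fewer than $\lambda$ formulas and finite quantifier strings. A fragment $\mathbb{A}$ is a set of formulas of $L_{\lambda,\omega}$ containing the atomic formulas and closed under subformulas, substitution of terms for variables, and the finitary first-order operations. $G$ is an $L_{\mathbb{A}}$-elementary substructure of $H$ if $G\subseteq H$ and for every $\varphi(\bar x)\in\mathbb{A}$ and $\bar a$ from $G$, $G\models\varphi(\bar a)$ iff $H\models\varphi(\bar a)$. Let $C$ be a class of structures of one similarity type and $<_C$ a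 binary relation on $C$; write $M\subseteq N$ for "$M$ is a substructure of $N$". $(C,<_C)$ is an abstract elementary class if: (A0) $C$ and $<_C$ are closed under isomorphism: if $f$ is an isomorphism of $M\in C$ onto $N$ then $N\in C$; and if $f_i$ is an isomorphism from $M_i$ onto $N_i$ ($i=0,1$), $M_0<_C M_1$ and $f_0\subseteq f_1$, then $N_0<_C N_1$. (A1) $<_C$ is a (reflexive) partial order on $C$. (A2) If $M<_C N$ then $M\subseteq N$. (A3) If $\langle A_\alpha:\alpha<\delta\rangle$ ($\delta$ a nonzero ordinal) is a continuous $<_C$-increasing chain (all $A_\alpha\in C$, $A_\alpha<_C A_{\alpha+1}$, and $A_\xi=\bigcup_{\zeta<\xi}A_\zeta$ for limit $\xi$), then (1) $\bigcup_{\alpha<\delta}A_\alpha\in C$; (2) for each $\beta<\delta$, $A_\beta<_C\bigcup_{\alpha<\delta}A_\alpha$; (3) if $A_\beta<_C M\in C$ for each $\beta<\delta$, then $\bigcup_{\alpha<\delta}A_\alpha<_C M$. (A4) If $A,B,D\in C$, $A<_C D$, $B<_C D$ and $A\subseteq B$, then $A<_C B$. (A5) There is a cardinal $\mathrm{LS}(C)$ (a Löwenheim–Skolem number) such that if $A\subseteq B\in C$, there exists $A'\in C$ with $A\subseteq A'$, $A'<_C B$ and $|A'|\le|A|+\mathrm{LS}(C)$. The assertion about $\mathrm{LS}(K)$ means that (A5) holds with $\mathrm{LS}(K)=|\mathbb{A}|$. -}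

module Defs where

open import Algebra.Bundles using (AbelianGroup)
open import Algebra.Structures using (IsAbelianGroup)
open import Algebra.Morphism.Structures using (module GroupMorphisms)
import Algebra.Construct.DirectProduct as Product
import Algebra.Definitions.RawMonoid as Multiples
open import Data.Bool using (Bool; if_then_else_)
open import Data.Empty using (⊥)
open import Data.Fin using (Fin; zero; suc)
open import Data.Nat using (ℕ; zero; suc)
open import Data.Product using (Σ; Σ-syntax; ∃-syntax; _×_; _,_; proj₁; proj₂)
open import Data.Sum.Relation.Binary.Pointwise using (_⊎ₛ_)
open import Data.Vec using (Vec; []; _∷_; map; lookup)
open import Data.Vec.Relation.Unary.All using (All)
open import Data.Vec.Relation.Binary.Pointwise.Inductive using (Pointwise)
open import Function.Bundles using (Func; Injection; Bijection; _⇔_)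
open import Function.Definitions using (Surjective)
open import Induction.WellFounded using (WellFounded)
open import Level using (Level; 0ℓ; _⊔_)
open import Relation.Binary.Bundles using (Setoid)
open import Relation.Binary.PropositionalEquality as ≡ using (_≡_; refl; _→-setoid_)
open import Relation.Binary.Structures using (IsStrictTotalOrder)
open import Relation.Nullary using (¬_)

1ℓ : Level
1ℓ = Level.suc 0ℓ

-- The axiom of choice for sets with an equality: the choice function must
-- respect the equalities, which is what separates this from the
-- provable distributivity of Π over Σ.
AxiomOfChoice : Set₁
AxiomOfChoice =
  (A B : Setoid 0ℓ 0ℓ) (R : Setoid.Carrier A → Setoid.Carrier B → Set) →
  (∀ {a a′ b b′} → Setoid._≈_ A a a′ → Setoid._≈_ B b b′ → R a b → R a′ b′) →
  (∀ a → ∃[ b ] R a b) →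
  Σ[ f ∈ Func A B ] (∀ a → R a (Func.to f a))

-- A cardinal is represented by any small setoid of that cardinality.

infix 4 _≤ᶜ_ _<ᶜ_

_≤ᶜ_ : Setoid 0ℓ 0ℓ → Setoid 0ℓ 0ℓ → Set
X ≤ᶜ Y = Injection X Y

_<ᶜ_ : Setoid 0ℓ 0ℓ → Setoid 0ℓ 0ℓ → Set
X <ᶜ Y = X ≤ᶜ Y × ¬ (Y ≤ᶜ X)

record IsSuccessorCardinal (κ Λ : Setoid 0ℓ 0ℓ) : Set₁ where
  field
    larger : κ <ᶜ Λ
    least  : ∀ μ → κ <ᶜ μ → Λ ≤ᶜ μ

2^ℵ₀ : Setoid 0ℓ 0ℓ
2^ℵ₀ = ℕ →-setoid Bool

-- The cumulative hierarchy (Aczel's type of iterative sets).  Universes of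
-- structures are sets in V, so that inclusions between structures, unions
-- of chains and antisymmetry have their literal set-theoretic meaning.

data V : Set₁ where
  sup : (I : Set) → (I → V) → V

El : V → Set
El (sup I a) = I

name : (a : V) → El a → V
name (sup I a) = a

infix 4 _≐_ _∈_ _⊆_

_≐_ : V → V → Set
sup I a ≐ sup J b =
  (∀ i → ∃[ j ] a i ≐ b j) × (∀ j → ∃[ i ] a i ≐ b j)

_∈_ : V → V → Set
v ∈ a = ∃[ x ] name a x ≐ v

_⊆_ : V → V → Set₁
a ⊆ b = ∀ v → v ∈ a → v ∈ b

≐-refl : ∀ a → a ≐ a
≐-refl (sup I a) = (λ i → i , ≐-refl (a i)) , (λ i → i , ≐-refl (a i))

≐-sym : ∀ a b → a ≐ b → b ≐ a
≐-sym (sup I a) (sup J b) (p , q) =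
  (λ j → proj₁ (q j) , ≐-sym (a _) (b j) (proj₂ (q j))) ,
  (λ i → proj₁ (p i) , ≐-sym (a i) (b _) (proj₂ (p i)))

≐-trans : ∀ a b c → a ≐ b → b ≐ c → a ≐ c
≐-trans (sup I a) (sup J b) (sup K c) (p , q) (r , s) =
  (λ i → let (j , e) = p i; (k , e′) = r j in k , ≐-trans (a i) (b j) (c k) e e′) ,
  (λ k → let (j , e′) = s k; (i , e) = q j in i , ≐-trans (a i) (b j) (c k) e e′)

⟪_⟫ : V → Setoid 0ℓ 0ℓ
⟪ a ⟫ = record
  { Carrier       = El a
  ; _≈_           = λ x y → name a x ≐ name a y
  ; isEquivalence = record
    { refl  = λ {x} → ≐-refl (name a x)
    ; sym   = λ {x} {y} → ≐-sym (name a x) (name a y)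
    ; trans = λ {x} {y} {z} → ≐-trans (name a x) (name a y) (name a z)
    }
  }

record Signature : Set₁ where
  field
    Fun   : Set
    Rel   : Set
    arity : Fun → ℕ
    rank  : Rel → ℕ

open Signature

record Structure (L : Signature) : Set₁ where
  field
    dom : V

  Carrier : Set
  Carrier = El dom

  infix 4 _≈_
  _≈_ : Carrier → Carrier → Set
  _≈_ = Setoid._≈_ ⟪ dom ⟫

  field
    fun      : (f : Fun L) → Vec Carrier (arity L f) → Carrier
    fun-cong : ∀ f {xs ys} → Pointwise _≈_ xs ys → fun f xs ≈ fun f ys
    rel      : (R : Rel L) → Vec Carrier (rank L R) → Set
    rel-cong : ∀ R {xs ys} → Pointwise _≈_ xs ys → rel R xs → rel R ys

open Structure using (dom; Carrier; fun; rel)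

private
  variable
    L   : Signature
    Λ   : Setoid 0ℓ 0ℓ
    m n : ℕ

-- The tuple xs of elements of a is the tuple vs of sets.
Names : (a : V) → Vec (El a) n → Vec V n → Set₁
Names a = Pointwise (λ x v → name a x ≐ v)

-- The interpretations of symbols as sets of tuples.
FunGraph : (M : Structure L) (f : Fun L) → Vec V (arity L f) → V → Set₁
FunGraph M f vs w =
  ∃[ xs ] Names (dom M) xs vs × name (dom M) (fun M f xs) ≐ w

RelGraph : (M : Structure L) (R : Rel L) → Vec V (rank L R) → Set₁
RelGraph M R vs = ∃[ xs ] Names (dom M) xs vs × rel M R xs

record SameStructure (M N : Structure L) : Set₁ where
  field
    same-dom : ∀ v → v ∈ dom M ⇔ v ∈ dom N
    same-fun : ∀ f vs w → FunGraph M f vs w ⇔ FunGraph N f vs w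
    same-rel : ∀ R vs → RelGraph M R vs ⇔ RelGraph N R vs

record Substructure (M N : Structure L) : Set₁ where
  field
    sub-dom : dom M ⊆ dom N
    sub-fun : ∀ f vs w → FunGraph M f vs w → FunGraph N f vs w
    sub-rel : ∀ R vs → All (_∈ dom M) vs → RelGraph M R vs ⇔ RelGraph N R vs

record IsUnion {I : Set} (A : I → Structure L) (U : Structure L) : Set₁ where
  field
    union-dom : ∀ v → v ∈ dom U ⇔ (∃[ i ] v ∈ dom (A i))
    union-fun : ∀ f vs w → FunGraph U f vs w ⇔ (∃[ i ] FunGraph (A i) f vs w)
    union-rel : ∀ R vs → RelGraph U R vs ⇔ (∃[ i ] RelGraph (A i) R vs)

record Isomorphism (M N : Structure L) : Set where
  field
    bijection : Bijection ⟪ dom M ⟫ ⟪ dom N ⟫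

  to : Carrier M → Carrier N
  to = Bijection.to bijection

  field
    fun-homo : ∀ f xs → Structure._≈_ N (to (fun M f xs)) (fun N f (map to xs))
    rel-homo : ∀ R xs → rel M R xs ⇔ rel N R (map to xs)

_extendedBy_ : {M₀ N₀ M₁ N₁ : Structure L} →
               Isomorphism M₀ N₀ → Isomorphism M₁ N₁ → Set
_extendedBy_ {M₀ = M₀} {N₀} {M₁} {N₁} f₀ f₁ =
  ∀ x → ∃[ y ] name (dom M₀) x ≐ name (dom M₁) y ×
    name (dom N₀) (Isomorphism.to f₀ x) ≐ name (dom N₁) (Isomorphism.to f₁ y)

-- An ordinal is represented by a well-ordered set, whose elements stand for the
-- smaller ordinals.
record Ordinal : Set₁ where
  infix 4 _<_
  field
    Index              : Set
    _<_                : Index → Index → Set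
    isStrictTotalOrder : IsStrictTotalOrder _≡_ _<_
    wellFounded        : WellFounded _<_

  IsNext : Index → Index → Set
  IsNext α β = α < β × (∀ γ → α < γ → ¬ γ < β)

  IsLimit : Index → Set
  IsLimit ξ = (∃[ ζ ] ζ < ξ) × (∀ ζ → ¬ IsNext ζ ξ)

record IsContinuousChain {c ℓ} (C : Structure L → Set c)
         (_≺_ : Structure L → Structure L → Set ℓ)
         (δ : Ordinal) (A : Ordinal.Index δ → Structure L) : Set (1ℓ ⊔ c ⊔ ℓ) where
  open Ordinal δ
  field
    inClass    : ∀ α → C (A α)
    increasing : ∀ α β → IsNext α β → A α ≺ A β
    continuous : ∀ ξ → IsLimit ξ →
                 IsUnion {I = ∃[ ζ ] ζ < ξ} (λ (ζ , _) → A ζ) (A ξ)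

-- Here a is an arbitrary subset of the universe of B, not necessarily closed
-- under the operations.
IsLSNumber : ∀ {c ℓ} → (Structure L → Set c) →
             (Structure L → Structure L → Set ℓ) →
             Setoid 0ℓ 0ℓ → Set (1ℓ ⊔ c ⊔ ℓ)
IsLSNumber C _≺_ κ =
  ∀ a B → C B → a ⊆ dom B →
  ∃[ A′ ] C A′ × a ⊆ dom A′ × A′ ≺ B × ⟪ dom A′ ⟫ ≤ᶜ (⟪ a ⟫ ⊎ₛ κ)

record IsAEC {c ℓ} (C : Structure L → Set c)
         (_≺_ : Structure L → Structure L → Set ℓ) : Set (1ℓ ⊔ c ⊔ ℓ) where
  field
    onClass : ∀ {M N} → M ≺ N → C M × C N

    iso-class : ∀ {M N} → Isomorphism M N → C M → C N
    iso-order : ∀ {M₀ N₀ M₁ N₁} (f₀ : Isomorphism M₀ N₀) (f₁ : Isomorphism M₁ N₁) →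
                M₀ ≺ M₁ → f₀ extendedBy f₁ → N₀ ≺ N₁

    reflexive     : ∀ {M} → C M → M ≺ M
    transitive    : ∀ {M N P} → M ≺ N → N ≺ P → M ≺ P
    antisymmetric : ∀ {M N} → M ≺ N → N ≺ M → SameStructure M N

    substructure : ∀ {M N} → M ≺ N → Substructure M N

    -- The inhabitant of the index set says that δ is nonzero.  IsUnion determines
    -- U up to SameStructure.
    chain : ∀ (δ : Ordinal) (A : Ordinal.Index δ → Structure L) →
            Ordinal.Index δ → IsContinuousChain C _≺_ δ A →
            Σ[ U ∈ Structure L ] IsUnion A U × C U × (∀ β → A β ≺ U) ×
              (∀ M → C M → (∀ β → A β ≺ M) → U ≺ M)

    coherence : ∀ {A B D} → C A → C B → C D →
                A ≺ D → B ≺ D → Substructure A B → A ≺ B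

    löwenheimSkolem : ∃[ κ ] IsLSNumber C _≺_ κ

data Term (L : Signature) (n : ℕ) : Set where
  var : Fin n → Term L n
  app : (f : Fun L) → Vec (Term L n) (arity L f) → Term L n

-- Formulas of L_{Λ,ω} in the free variables 0, …, n-1; a quantifier binds
-- variable 0 and shifts the others.  Implication is definable from neg and or.
data Formula (L : Signature) (Λ : Setoid 0ℓ 0ℓ) (n : ℕ) : Set₁ where
  equ     : Term L n → Term L n → Formula L Λ n
  pred    : (R : Rel L) → Vec (Term L n) (rank L R) → Formula L Λ n
  neg     : Formula L Λ n → Formula L Λ n
  ⋀ ⋁     : (I : Set) → ≡.setoid I <ᶜ Λ → (I → Formula L Λ n) → Formula L Λ n
  all ex  : Formula L Λ (suc n) → Formula L Λ n

Sentence : Signature → Setoid 0ℓ 0ℓ → Set₁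
Sentence L Λ = Formula L Λ 0

and or : ≡.setoid Bool <ᶜ Λ → Formula L Λ n → Formula L Λ n → Formula L Λ n
and s φ χ = ⋀ Bool s (λ b → if b then φ else χ)
or  s φ χ = ⋁ Bool s (λ b → if b then φ else χ)

-- Identity of formulas, where ⋀ and ⋁ are applied to the *set* of
-- formulas enumerated by the family (repetitions and the choice of index set
-- do not count).
infix 4 _≋_

_≋_ : Formula L Λ n → Formula L Λ n → Set
equ t u ≋ equ t′ u′ = t ≡ t′ × u ≡ u′
_≋_ {L} {n = n} (pred R ts) (pred R′ ts′) =
  _≡_ {A = Σ[ S ∈ Rel L ] Vec (Term L n) (rank L S)} (R , ts) (R′ , ts′)
neg φ ≋ neg χ = φ ≋ χ
⋀ I _ φ ≋ ⋀ J _ χ = (∀ i → ∃[ j ] φ i ≋ χ j) × (∀ j → ∃[ i ] φ i ≋ χ j)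
⋁ I _ φ ≋ ⋁ J _ χ = (∀ i → ∃[ j ] φ i ≋ χ j) × (∀ j → ∃[ i ] φ i ≋ χ j)
all φ ≋ all χ = φ ≋ χ
ex φ ≋ ex χ = φ ≋ χ
_ ≋ _ = ⊥

≋-refl : (φ : Formula L Λ n) → φ ≋ φ
≋-refl (equ t u) = refl , refl
≋-refl (pred R ts) = refl
≋-refl (neg φ) = ≋-refl φ
≋-refl (⋀ I s φ) = (λ i → i , ≋-refl (φ i)) , (λ i → i , ≋-refl (φ i))
≋-refl (⋁ I s φ) = (λ i → i , ≋-refl (φ i)) , (λ i → i , ≋-refl (φ i))
≋-refl (all φ) = ≋-refl φ
≋-refl (ex φ) = ≋-refl φ

≋-sym : (φ χ : Formula L Λ n) → φ ≋ χ → χ ≋ φ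
≋-sym (equ _ _) (equ _ _) (p , q) = ≡.sym p , ≡.sym q
≋-sym (pred _ _) (pred _ _) p = ≡.sym p
≋-sym (neg φ) (neg χ) p = ≋-sym φ χ p
≋-sym (⋀ _ _ φ) (⋀ _ _ χ) (p , q) =
  (λ j → proj₁ (q j) , ≋-sym (φ _) (χ j) (proj₂ (q j))) ,
  (λ i → proj₁ (p i) , ≋-sym (φ i) (χ _) (proj₂ (p i)))
≋-sym (⋁ _ _ φ) (⋁ _ _ χ) (p , q) =
  (λ j → proj₁ (q j) , ≋-sym (φ _) (χ j) (proj₂ (q j))) ,
  (λ i → proj₁ (p i) , ≋-sym (φ i) (χ _) (proj₂ (p i)))
≋-sym (all φ) (all χ) p = ≋-sym φ χ p
≋-sym (ex φ) (ex χ) p = ≋-sym φ χ p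

≋-trans : (φ χ θ : Formula L Λ n) → φ ≋ χ → χ ≋ θ → φ ≋ θ
≋-trans (equ _ _) (equ _ _) (equ _ _) (p , q) (r , s) = ≡.trans p r , ≡.trans q s
≋-trans (pred _ _) (pred _ _) (pred _ _) p q = ≡.trans p q
≋-trans (neg φ) (neg χ) (neg θ) p q = ≋-trans φ χ θ p q
≋-trans (⋀ _ _ φ) (⋀ _ _ χ) (⋀ _ _ θ) (p , q) (r , s) =
  (λ i → let (j , e) = p i; (k , e′) = r j in k , ≋-trans (φ i) (χ j) (θ k) e e′) ,
  (λ k → let (j , e′) = s k; (i , e) = q j in i , ≋-trans (φ i) (χ j) (θ k) e e′)
≋-trans (⋁ _ _ φ) (⋁ _ _ χ) (⋁ _ _ θ) (p , q) (r , s) =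
  (λ i → let (j , e) = p i; (k , e′) = r j in k , ≋-trans (φ i) (χ j) (θ k) e e′) ,
  (λ k → let (j , e′) = s k; (i , e) = q j in i , ≋-trans (φ i) (χ j) (θ k) e e′)
≋-trans (all φ) (all χ) (all θ) p q = ≋-trans φ χ θ p q
≋-trans (ex φ) (ex χ) (ex θ) p q = ≋-trans φ χ θ p q

mutual
  renameTerm : (Fin n → Fin m) → Term L n → Term L m
  renameTerm ρ (var i)    = var (ρ i)
  renameTerm ρ (app f ts) = app f (renameTerms ρ ts)

  renameTerms : ∀ {k} → (Fin n → Fin m) → Vec (Term L n) k → Vec (Term L m) k
  renameTerms ρ []       = []
  renameTerms ρ (t ∷ ts) = renameTerm ρ t ∷ renameTerms ρ ts

mutual
  substTerm : (Fin n → Term L m) → Term L n → Term L m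
  substTerm σ (var i)    = σ i
  substTerm σ (app f ts) = app f (substTerms σ ts)

  substTerms : ∀ {k} → (Fin n → Term L m) → Vec (Term L n) k → Vec (Term L m) k
  substTerms σ []       = []
  substTerms σ (t ∷ ts) = substTerm σ t ∷ substTerms σ ts

lift : (Fin n → Term L m) → Fin (suc n) → Term L (suc m)
lift σ zero    = var zero
lift σ (suc i) = renameTerm suc (σ i)

subst : (Fin n → Term L m) → Formula L Λ n → Formula L Λ m
subst σ (equ t u)  = equ (substTerm σ t) (substTerm σ u)
subst σ (pred R ts) = pred R (substTerms σ ts)
subst σ (neg φ)    = neg (subst σ φ)
subst σ (⋀ I s φ)  = ⋀ I s (λ i → subst σ (φ i))
subst σ (⋁ I s φ)  = ⋁ I s (λ i → subst σ (φ i))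
subst σ (all φ)    = all (subst (lift σ) φ)
subst σ (ex φ)     = ex (subst (lift σ) φ)

mutual
  eval : (M : Structure L) → Vec (Carrier M) n → Term L n → Carrier M
  eval M xs (var i)    = lookup xs i
  eval M xs (app f ts) = fun M f (evals M xs ts)

  evals : ∀ {k} (M : Structure L) → Vec (Carrier M) n →
          Vec (Term L n) k → Vec (Carrier M) k
  evals M xs []       = []
  evals M xs (t ∷ ts) = eval M xs t ∷ evals M xs ts

infix 4 _⊨_[_] _⊨_

_⊨_[_] : (M : Structure L) → Formula L Λ n → Vec (Carrier M) n → Set
M ⊨ equ t u  [ xs ] = Structure._≈_ M (eval M xs t) (eval M xs u)
M ⊨ pred R ts [ xs ] = rel M R (evals M xs ts)
M ⊨ neg φ    [ xs ] = ¬ (M ⊨ φ [ xs ])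
M ⊨ ⋀ I _ φ  [ xs ] = ∀ i → M ⊨ φ i [ xs ]
M ⊨ ⋁ I _ φ  [ xs ] = ∃[ i ] M ⊨ φ i [ xs ]
M ⊨ all φ    [ xs ] = ∀ x → M ⊨ φ [ x ∷ xs ]
M ⊨ ex φ     [ xs ] = ∃[ x ] M ⊨ φ [ x ∷ xs ]

_⊨_ : Structure L → Sentence L Λ → Set
M ⊨ ψ = M ⊨ ψ [ [] ]

-- A fragment is a small set of formulas, given by an enumeration (possibly with
-- repetitions) of its members in each number of free variables.
record Fragment (L : Signature) (Λ : Setoid 0ℓ 0ℓ) : Set₁ where
  field
    Code    : ℕ → Set
    formula : Code n → Formula L Λ n

  Member : Formula L Λ n → Set
  Member φ = ∃[ c ] formula c ≋ φ

  field
    equ∈ : (t u : Term L n) → Member (equ t u)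
    pred∈ : ∀ R (ts : Vec (Term L n) (rank L R)) → Member (pred R ts)

    neg-sub : {φ : Formula L Λ n} → Member (neg φ) → Member φ
    ⋀-sub   : ∀ {I s} {φ : I → Formula L Λ n} → Member (⋀ I s φ) → ∀ i → Member (φ i)
    ⋁-sub   : ∀ {I s} {φ : I → Formula L Λ n} → Member (⋁ I s φ) → ∀ i → Member (φ i)
    all-sub : {φ : Formula L Λ (suc n)} → Member (all φ) → Member φ
    ex-sub  : {φ : Formula L Λ (suc n)} → Member (ex φ) → Member φ

    subst∈ : (σ : Fin n → Term L m) {φ : Formula L Λ n} → Member φ → Member (subst σ φ)

    neg∈ : {φ : Formula L Λ n} → Member φ → Member (neg φ)
    and∈ : ∀ s {φ χ : Formula L Λ n} → Member φ → Member χ → Member (and s φ χ)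
    or∈  : ∀ s {φ χ : Formula L Λ n} → Member φ → Member χ → Member (or s φ χ)
    all∈ : {φ : Formula L Λ (suc n)} → Member φ → Member (all φ)
    ex∈  : {φ : Formula L Λ (suc n)} → Member φ → Member (ex φ)

infix 4 _∈ᶠ_

_∈ᶠ_ : Formula L Λ n → Fragment L Λ → Set
φ ∈ᶠ 𝔸 = Fragment.Member 𝔸 φ

-- The cardinality of a fragment: repetitions in the enumeration are identified.
∣_∣ : Fragment L Λ → Setoid 0ℓ 0ℓ
∣ 𝔸 ∣ = record
  { Carrier       = Σ ℕ Code
  ; _≈_           = λ (n , c) (m , d) → Σ[ e ∈ n ≡ m ] formula (≡.subst Code e c) ≋ formula d
  ; isEquivalence = record
    { refl  = λ {(n , c)} → refl , ≋-refl (formula c)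
    ; sym   = λ {(n , c)} {(m , d)} → λ { (refl , p) → refl , ≋-sym (formula c) (formula d) p }
    ; trans = λ {(n , c)} {(m , d)} {(k , e)} → λ { (refl , p) (refl , q) →
                refl , ≋-trans (formula c) (formula d) (formula e) p q }
    }
  }
  where open Fragment 𝔸

record ElementarySubstructure (𝔸 : Fragment L Λ) (M N : Structure L) : Set₁ where
  field
    isSubstructure : Substructure M N
    elementary     : ∀ {n} (φ : Formula L Λ n) → φ ∈ᶠ 𝔸 → ∀ xs ys →
                     Pointwise (λ x y → name (dom M) x ≐ name (dom N) y) xs ys →
                     M ⊨ φ [ xs ] ⇔ N ⊨ φ [ ys ]

Ab : Set₁
Ab = AbelianGroup 0ℓ 0ℓ

module _ (G H : Ab) where
  private
    module G = AbelianGroup G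
    module H = AbelianGroup H
  open GroupMorphisms G.rawGroup H.rawGroup

  IsHom IsMono IsIso : (G.Carrier → H.Carrier) → Set
  IsHom  = IsGroupHomomorphism
  IsMono = IsGroupMonomorphism
  IsIso  = IsGroupIsomorphism

TorsionFree : Ab → Set
TorsionFree J = ∀ n x → suc n · x ≈ ε → x ≈ ε
  where
  open AbelianGroup J
  open Multiples rawMonoid renaming (_×_ to _·_)

record Extension (J G : Ab) : Set₁ where
  private
    module J = AbelianGroup J
    module G = AbelianGroup G
  field
    E : Ab
  module E = AbelianGroup E
  field
    ι          : G.Carrier → E.Carrier
    π          : E.Carrier → J.Carrier
    ι-mono     : IsMono G E ι
    π-hom      : IsHom E J π
    π-onto     : Surjective E._≈_ J._≈_ π
    exact      : ∀ e → π e J.≈ J.ε ⇔ (∃[ g ] ι g E.≈ e)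

record EquivalentExtensions {J G : Ab} (X Y : Extension J G) : Set where
  private
    module X = Extension X
    module Y = Extension Y
  field
    h      : X.E.Carrier → Y.E.Carrier
    h-iso  : IsIso X.E Y.E h
    h-ι    : ∀ g → h (X.ι g) Y.E.≈ Y.ι g
    h-π    : ∀ e → AbelianGroup._≈_ J (Y.π (h e)) (X.π e)

-- The extension G → G × J → J, the zero of the group Ext(J,G) of classes of
-- extensions under Baer sum.
zeroExtension : (J G : Ab) → Extension J G
zeroExtension J G = record
  { E      = Product.abelianGroup G J
  ; ι      = λ g → g , J.ε
  ; π      = proj₂
  ; ι-mono = record
    { isGroupHomomorphism = record
      { isMonoidHomomorphism = record
        { isMagmaHomomorphism = record
          { isRelHomomorphism = record { cong = λ p → p , J.refl }
          ; homo = λ _ _ → G.refl , J.sym (J.identityˡ J.ε)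
          }
        ; ε-homo = G.refl , J.refl
        }
      ; ⁻¹-homo = λ _ → G.refl , J.trans (J.sym (J.inverseʳ J.ε)) (J.identityˡ (J.ε J.⁻¹))
      }
    ; injective = proj₁
    }
  ; π-hom  = record
    { isMonoidHomomorphism = record
      { isMagmaHomomorphism = record
        { isRelHomomorphism = record { cong = proj₂ }
        ; homo = λ _ _ → J.refl
        }
      ; ε-homo = J.refl
      }
    ; ⁻¹-homo = λ _ → J.refl
    }
  ; π-onto = λ j → (G.ε , j) , proj₂
  ; exact  = λ (g , j) → record
    { to        = λ p → g , G.refl , J.sym p
    ; from      = λ (_ , _ , p) → J.sym p
    ; to-cong   = λ { refl → refl }
    ; from-cong = λ { refl → refl }
    }
  }
  where
  module J = AbelianGroup J
  module G = AbelianGroup G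

ExtVanishes : Ab → Ab → Set₁
ExtVanishes J G = (X : Extension J G) → EquivalentExtensions X (zeroExtension J G)

Cotorsion : Ab → Set₁
Cotorsion G = (J : Ab) → TorsionFree J → ExtVanishes J G

record Subgroup (G : Ab) : Set₁ where
  field
    group       : Ab
    inclusion   : AbelianGroup.Carrier group → AbelianGroup.Carrier G
    isInclusion : IsMono group G inclusion

Nonzero : Ab → Set
Nonzero G = ¬ (∀ x → x ≈ ε)
  where open AbelianGroup G

CotorsionFree : Ab → Set₁
CotorsionFree G =
  ¬ (Σ[ H ∈ Subgroup G ] Nonzero (Subgroup.group H) × Cotorsion (Subgroup.group H))

data GroupSymbol : Set where
  plus minus zero : GroupSymbol

groupSignature : Signature
groupSignature = record
  { Fun   = GroupSymbol
  ; Rel   = ⊥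
  ; arity = λ { plus → 2 ; minus → 1 ; zero → 0 }
  ; rank  = λ ()
  }

module _ (M : Structure groupSignature) where
  open Structure M using (_≈_)

  add : Carrier M → Carrier M → Carrier M
  add x y = fun M plus (x ∷ y ∷ [])

  0# : Carrier M
  0# = fun M zero []

  negate : Carrier M → Carrier M
  negate x = fun M minus (x ∷ [])

  K : Set₁
  K = Σ[ ab ∈ IsAbelianGroup _≈_ add 0# negate ]
        CotorsionFree (record { isAbelianGroup = ab })

infix 4 _≺[_]_

_≺[_]_ : Structure groupSignature → Fragment groupSignature Λ →
         Structure groupSignature → Set₁
G ≺[ 𝔸 ] H = K G × K H × ElementarySubstructure 𝔸 G H

{-# OPTIONS --safe #-}
-- Membership of ψ in 𝔸 makes K closed under isomorphisms and under 𝔸-elementary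
-- substructures and extensions, so nothing about cotorsionfree groups is used and the
-- axioms reduce to facts about 𝔸-elementary substructures.  Unions of chains are handled
-- by the Tarski–Vaught argument, applied to all members of the chain at once; elementarity
-- between any two members follows by transfinite induction on the larger index.
--
-- For (A5), close a ⊆ B under Skolem functions for the formulas of 𝔸.  The elements of
-- this hull are values of finite binary trees with leaves in the infinite set
-- X = a ⊎ 𝔸, so the bound on its cardinality follows from |X × X| ≤ |X|, which pairs up
-- trees injectively.  That inequality is Tarski's theorem, derived from Zorn's lemma: if a
-- maximal injective pairing S × S → S with ℕ ⊆ S ⊆ X has |S| ≤ |X ∖ S|, it extends to S and
-- a disjoint copy of S; otherwise |X| ≤ |S ⊎ S| ≤ |S|.

module Submission where

open import Defs
open import Axiom.ExcludedMiddle using (ExcludedMiddle)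
open import Axiom.UniquenessOfIdentityProofs.WithK using (uip)
open import Data.Bool using (Bool; false; T)
open import Data.Bool.Properties using (T-irrelevant)
open import Data.Empty using (⊥-elim)
open import Data.Fin using (Fin; zero; suc)
open import Data.Nat using (ℕ; zero; suc; _+_; _*_)
import Data.Nat as ℕ
import Data.Nat.Properties as ℕₚ
open import Data.Product using (Σ; Σ-syntax; ∃-syntax; _×_; _,_; proj₁; proj₂)
open import Data.Sum using (_⊎_; inj₁; inj₂; [_,_]′)
open import Data.Sum.Properties using (inj₁-injective; inj₂-injective)
open import Data.Sum.Relation.Binary.Pointwise using (_⊎ₛ_; inj₁; inj₂)
open import Data.Unit using (⊤; tt)
open import Data.Vec using (Vec; []; _∷_; map; lookup; tabulate; replicate)
open import Data.Vec.Properties using (tabulate∘lookup; map-id)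
open import Data.Vec.Relation.Unary.All using (All; []; _∷_)
open import Data.Vec.Relation.Binary.Pointwise.Inductive as Pointwise using (Pointwise; []; _∷_)
open import Function.Base using (id; _∘_)
open import Function.Bundles using (Func; Injection; Bijection; _↣_; mk↣; _⇔_; mk⇔; Equivalence)
import Function.Construct.Composition as Composition
open Composition using (_⇔-∘_)
import Function.Construct.Identity as Identity
open import Function.Construct.Symmetry using (⇔-sym)
open import Induction.WellFounded using (Acc; acc)
open import Level using (Level; 0ℓ)
open import Relation.Binary.Bundles using (Setoid)
open import Relation.Binary.Definitions using (tri<; tri≈; tri>)
open import Relation.Binary.PropositionalEquality as ≡ using (_≡_; _≢_; refl; sym; trans; cong; cong₂)
open import Relation.Binary.Structures using (IsStrictTotalOrder)
open import Relation.Nullary using (¬_; Dec; yes; no; contradiction)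
open import Relation.Nullary.Decidable using (⌊_⌋; toWitness; fromWitness; True; map′; decidable-stable)

open Signature
open Structure using (dom; Carrier; fun; fun-cong; rel; rel-cong)
open Equivalence using (to; from)

lowerEM : ExcludedMiddle 1ℓ → ExcludedMiddle 0ℓ
lowerEM em = map′ Level.lower Level.lift em

-- Cardinal arithmetic

-- With `s = a + b`, the value `s * s + a` lies between `s * s` and `s * s + s`, hence below the
-- square of `s + 1`. So it determines `s`, then `a`, then `b`.
ℕ-pairing : (ℕ × ℕ) ↣ ℕ
ℕ-pairing = mk↣ {to = pair} pair-injective
  where
  pair : ℕ × ℕ → ℕ
  pair (a , b) = (a + b) * (a + b) + a

  gap : ∀ a b c d → a + b ℕ.< c + d → pair (a , b) ℕ.< pair (c , d)
  gap a b c d s<t = begin-strict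
    (a + b) * (a + b) + a             ≤⟨ ℕₚ.+-monoʳ-≤ ((a + b) * (a + b)) (ℕₚ.m≤m+n a b) ⟩
    (a + b) * (a + b) + (a + b)       ≡⟨ ℕₚ.+-comm ((a + b) * (a + b)) (a + b) ⟩
    suc (a + b) * (a + b)             <⟨ ℕₚ.*-monoʳ-< (suc (a + b)) (ℕₚ.n<1+n (a + b)) ⟩
    suc (a + b) * suc (a + b)         ≤⟨ ℕₚ.*-mono-≤ s<t s<t ⟩
    (c + d) * (c + d)                 ≤⟨ ℕₚ.m≤m+n _ c ⟩
    (c + d) * (c + d) + c             ∎
    where
    open ℕₚ.≤-Reasoning

  pair-injective : ∀ {x y} → pair x ≡ pair y → x ≡ y
  pair-injective {a , b} {c , d} e with ℕₚ.<-cmp (a + b) (c + d)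
  ... | tri< s<t _ _ = contradiction e (ℕₚ.<⇒≢ (gap a b c d s<t))
  ... | tri> _ _ t<s = contradiction (sym e) (ℕₚ.<⇒≢ (gap c d a b t<s))
  ... | tri≈ _ s≡t _ with refl ← ℕₚ.+-cancelˡ-≡ ((a + b) * (a + b)) a c
                                   (trans e (cong (λ s → s * s + c) (sym s≡t)))
    = cong (a ,_) (ℕₚ.+-cancelˡ-≡ a b d s≡t)

-- Subsets are Bool-valued, so that the powerset of a small set is small and the
-- axiom of choice applies to it.
𝒫 : Set → Set
𝒫 Y = Y → Bool

module _ {Y : Set} where

  infix 4 _⊑_ _∈ᵇ_

  _∈ᵇ_ : Y → 𝒫 Y → Set
  y ∈ᵇ S = T (S y)

  _⊑_ : 𝒫 Y → 𝒫 Y → Set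
  S ⊑ S′ = ∀ y → y ∈ᵇ S → y ∈ᵇ S′

  ⊑-refl : ∀ {S} → S ⊑ S
  ⊑-refl _ y∈S = y∈S

  ⊑-trans : ∀ {R S S′} → R ⊑ S → S ⊑ S′ → R ⊑ S′
  ⊑-trans p q y y∈R = q y (p y y∈R)

  ⊑-reflexive : ∀ {S S′} → S ≡ S′ → S ⊑ S′
  ⊑-reflexive refl = ⊑-refl

  MaximalIn : (𝒫 Y → Set) → 𝒫 Y → Set
  MaximalIn F S = ∀ S′ → F S′ → S ⊑ S′ → S′ ⊑ S

-- A property of `U`, which fixes it only up to mutual inclusion: without function extensionality,
-- subsets with the same elements need not be identical.
IsUnionOf : ∀ {Y} → 𝒫 (𝒫 Y) → 𝒫 Y → Set
IsUnionOf C U = (∀ S → S ∈ᵇ C → S ⊑ U) × (∀ {y} → y ∈ᵇ U → ∃[ S ] S ∈ᵇ C × y ∈ᵇ S)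

Linear : ∀ {Y} → 𝒫 (𝒫 Y) → Set
Linear C = ∀ S S′ → S ∈ᵇ C → S′ ∈ᵇ C → S ⊑ S′ ⊎ S′ ⊑ S

ChainClosed : ∀ {Y} → (𝒫 Y → Set) → Set
ChainClosed {Y} F = ∀ C U → (∃[ S ] S ∈ᵇ C) → (∀ S → S ∈ᵇ C → F S) → Linear C →
                    IsUnionOf C U → F U

data Tree (X : Set) : Set where
  leaf : X → Tree X
  node : Tree X → Tree X → Tree X

module Classical (em : ExcludedMiddle 1ℓ) (ac : AxiomOfChoice) where

  em₀ : ExcludedMiddle 0ℓ
  em₀ = lowerEM em

  comprehend : {Y : Set} → (Y → Set) → 𝒫 Y
  comprehend P y = ⌊ em₀ {P y} ⌋

  -- Zorn's lemma by the Bourbaki-Witt argument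

  module Zorn {Y : Set} (F : 𝒫 Y → Set) (chains : ChainClosed F) (S₀ : 𝒫 Y) (S₀∈F : F S₀) where

    -- A set with the same elements as `S` is a union of the one-member chain consisting of `S`.
    F-resp : ∀ {S S′} → S ⊑ S′ → S′ ⊑ S → F S → F S′
    F-resp {S} {S′} p q S∈F = chains (comprehend (_≡ S)) S′ (S , fromWitness refl)
      (λ R R∈ → ≡.subst F (sym (toWitness R∈)) S∈F)
      (λ R R′ R∈ R′∈ → inj₁ (⊑-reflexive (trans (toWitness R∈) (sym (toWitness R′∈)))))
      ( (λ R R∈ → ⊑-trans (⊑-reflexive (toWitness R∈)) p)
      , (λ y∈S′ → S , fromWitness refl , q _ y∈S′))

    -- The condition on a successor of `S`. Membership in `F` enters as an implication so that every
    -- subset has a successor, as the axiom of choice demands; the last clause says that only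
    -- maximal sets are left unenlarged.
    Extends : 𝒫 Y → 𝒫 Y → Set
    Extends S S′ = S ⊑ S′ × (F S → F S′) × (S′ ⊑ S → MaximalIn F S)

    extension : ∀ S → ∃[ S′ ] Extends S S′
    extension S with em₀ {∃[ S′ ] F S′ × S ⊑ S′ × ¬ (S′ ⊑ S)}
    ... | yes (S′ , S′∈F , S⊑S′ , S′⋢S) = S′ , S⊑S′ , (λ _ → S′∈F) , λ p → contradiction p S′⋢S
    ... | no none = S , ⊑-refl , id , λ _ S′ S′∈F S⊑S′ →
      decidable-stable em₀ (λ S′⋢S → none (S′ , S′∈F , S⊑S′ , S′⋢S))

    powerset : Setoid 0ℓ 0ℓ
    powerset = record
      { Carrier       = 𝒫 Y
      ; _≈_           = λ S S′ → S ⊑ S′ × S′ ⊑ S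
      ; isEquivalence = record
        { refl  = ⊑-refl , ⊑-refl
        ; sym   = λ (p , q) → q , p
        ; trans = λ (p , q) (p′ , q′) → ⊑-trans p p′ , ⊑-trans q′ q
        }
      }

    -- Subsets are taken up to mutual inclusion on the left and up to identity on the right, so the
    -- chosen successor depends only on the elements of a set; this yields `g-cong`.
    choice : Σ[ g ∈ Func powerset (≡.setoid (𝒫 Y)) ] (∀ S → Extends S (Func.to g S))
    choice = ac powerset (≡.setoid (𝒫 Y)) Extends
      (λ { (p , q) refl (r , s , t) →
           ⊑-trans q r , s ∘ F-resp q p ,
           λ u S″ S″∈F v → ⊑-trans (t (⊑-trans u q) S″ S″∈F (⊑-trans p v)) p })
      extension

    g : 𝒫 Y → 𝒫 Y
    g = Func.to (proj₁ choice)

    g-extends : ∀ S → Extends S (g S)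
    g-extends = proj₂ choice

    g-inflationary : ∀ {S} → S ⊑ g S
    g-inflationary {S} = proj₁ (g-extends S)

    g-cong : ∀ {S S′} → S ⊑ S′ → S′ ⊑ S → g S ⊑ g S′
    g-cong p q = ⊑-reflexive (Func.cong (proj₁ choice) (p , q))

    -- The Bourbaki–Witt tower.  Unions of arbitrary subfamilies are allowed, since the
    -- tower turns out to be linearly ordered.
    data Tower : 𝒫 Y → Set where
      base  : Tower S₀
      step  : ∀ {S} → Tower S → Tower (g S)
      union : ∀ {C U} → (∃[ S ] S ∈ᵇ C) → (∀ S → S ∈ᵇ C → Tower S) → IsUnionOf C U → Tower U

    S₀-least : ∀ {S} → Tower S → S₀ ⊑ S
    S₀-least base = ⊑-refl
    S₀-least (step s) = ⊑-trans (S₀-least s) g-inflationary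
    S₀-least (union (S , S∈C) ss (ub , _)) = ⊑-trans (S₀-least (ss S S∈C)) (ub S S∈C)

    -- The extreme points of the Bourbaki-Witt proof. They are comparable with the whole tower, and
    -- every tower member turns out to be one.
    Extreme : 𝒫 Y → Set
    Extreme S = ∀ {R} → Tower R → R ⊑ S → ¬ (S ⊑ R) → g R ⊑ S

    -- Induction on the construction of `R`. At a step with `R ⊑ S`, either `R` has the elements of
    -- `S`, so that `g S ⊑ g R`, or extremality gives `g R ⊑ S`. At a union, either one member
    -- contains `g S` or all of them lie below `S`.
    extreme-compare : ∀ {S} → Extreme S → ∀ {R} → Tower R → Tower S → R ⊑ S ⊎ g S ⊑ R
    extreme-compare ext base s = inj₁ (S₀-least s)
    extreme-compare {S} ext (step {R} r) s with extreme-compare ext r s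
    ... | inj₂ gS⊑R = inj₂ (⊑-trans gS⊑R g-inflationary)
    ... | inj₁ R⊑S with em₀ {S ⊑ R}
    ...   | yes S⊑R = inj₂ (g-cong S⊑R R⊑S)
    ...   | no S⋢R = inj₁ (ext r R⊑S S⋢R)
    extreme-compare {S} ext (union {C} {U} _ rs (ub , lub)) s with em₀ {∃[ R ] R ∈ᵇ C × g S ⊑ R}
    ... | yes (R , R∈C , gS⊑R) = inj₂ (⊑-trans gS⊑R (ub R R∈C))
    ... | no none = inj₁ λ y y∈U → let (R , R∈C , y∈R) = lub y∈U in
      [ (λ R⊑S → R⊑S y y∈R) , (λ gS⊑R → ⊥-elim (none (R , R∈C , gS⊑R))) ]′
        (extreme-compare ext (rs R R∈C) s)

    extreme : ∀ {S} → Tower S → Extreme S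
    extreme base r R⊑S₀ S₀⋢R = contradiction (S₀-least r) S₀⋢R
    extreme (step {S} s) {R} r R⊑gS gS⋢R with extreme-compare (extreme s) r s
    ... | inj₂ gS⊑R = contradiction gS⊑R gS⋢R
    ... | inj₁ R⊑S with em₀ {S ⊑ R}
    ...   | yes S⊑R = g-cong R⊑S S⊑R
    ...   | no S⋢R = ⊑-trans (extreme s r R⊑S S⋢R) g-inflationary
    extreme (union {C} {U} ne ss isU@(ub , lub)) {R} r R⊑U U⋢R
      with em₀ {∃[ S ] S ∈ᵇ C × R ⊑ S}
    ... | no none = contradiction
      (λ y y∈U → let (S , S∈C , y∈S) = lub y∈U in
        [ (λ R⊑S → ⊥-elim (none (S , S∈C , R⊑S))) , (λ gS⊑R → gS⊑R y (g-inflationary y y∈S)) ]′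
          (extreme-compare (extreme (ss S S∈C)) r (ss S S∈C)))
      U⋢R
    ... | yes (S , S∈C , R⊑S) with em₀ {S ⊑ R}
    ...   | no S⋢R = ⊑-trans (extreme (ss S S∈C) r R⊑S S⋢R) (ub S S∈C)
    -- Here `R` and `S` have the same elements, so extremality of `S` says nothing about `g R`;
    -- comparing the whole union `U` with `S` does.
    ...   | yes S⊑R with extreme-compare (extreme (ss S S∈C)) (union ne ss isU) (ss S S∈C)
    ...     | inj₁ U⊑S = contradiction (⊑-trans U⊑S S⊑R) U⋢R
    ...     | inj₂ gS⊑U = ⊑-trans (g-cong R⊑S S⊑R) gS⊑U

    tower-linear : ∀ {R S} → Tower R → Tower S → R ⊑ S ⊎ S ⊑ R
    tower-linear r s with extreme-compare (extreme s) r s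
    ... | inj₁ R⊑S = inj₁ R⊑S
    ... | inj₂ gS⊑R = inj₂ (⊑-trans g-inflationary gS⊑R)

    tower⊆F : ∀ {S} → Tower S → F S
    tower⊆F base = S₀∈F
    tower⊆F (step {S} s) = proj₁ (proj₂ (g-extends S)) (tower⊆F s)
    tower⊆F (union {C} {U} ne ss isU) = chains C U ne (λ S S∈C → tower⊆F (ss S S∈C))
      (λ S S′ S∈C S′∈C → tower-linear (ss S S∈C) (ss S′ S′∈C)) isU

    top : 𝒫 Y
    top = comprehend (λ y → ∃[ S ] Tower S × y ∈ᵇ S)

    -- The tower is itself a nonempty family of tower members, so its union is again a member.
    top-tower : Tower top
    top-tower = union {C = comprehend Tower} (S₀ , fromWitness base) (λ S → toWitness)
      ( (λ S S∈C y y∈S → fromWitness (S , toWitness S∈C , y∈S))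
      , (λ y∈top → let (S , s , y∈S) = toWitness y∈top in S , fromWitness s , y∈S))

    -- As `g top` belongs to the tower, it lies below `top`, and the last clause of `Extends` makes
    -- `top` maximal.
    zorn : ∃[ M ] F M × S₀ ⊑ M × MaximalIn F M
    zorn = top , tower⊆F top-tower , S₀-least top-tower ,
      proj₂ (proj₂ (g-extends top)) (λ y y∈ → fromWitness (g top , step top-tower , y∈))

  -- Of two members of the chain, the larger one contains both elements. Hence conditions involving
  -- two elements at a time pass to unions of chains.
  common : ∀ {Y} {C : 𝒫 (𝒫 Y)} {U} → Linear C → IsUnionOf C U → ∀ {y y′} → y ∈ᵇ U → y′ ∈ᵇ U →
           ∃[ S ] S ∈ᵇ C × y ∈ᵇ S × y′ ∈ᵇ S
  common linear (_ , lub) y∈U y′∈U with lub y∈U | lub y′∈U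
  ... | S , S∈C , y∈S | S′ , S′∈C , y′∈S′ with linear S S′ S∈C S′∈C
  ...   | inj₁ S⊑S′ = S′ , S′∈C , S⊑S′ _ y∈S , y′∈S′
  ...   | inj₂ S′⊑S = S , S∈C , y∈S , S′⊑S _ y′∈S′

  -- Comparability of cardinals

  module _ {A B : Set} where

    record PartialInjection (G : 𝒫 (A × B)) : Set where
      field
        functional : ∀ {a b b′} → (a , b) ∈ᵇ G → (a , b′) ∈ᵇ G → b ≡ b′
        injective  : ∀ {a a′ b} → (a , b) ∈ᵇ G → (a′ , b) ∈ᵇ G → a ≡ a′

    open PartialInjection

    partialInjection-chains : ChainClosed PartialInjection
    partialInjection-chains C U _ ps linear isU = record
      { functional = λ p q → let (S , S∈C , p′ , q′) = common linear isU p q in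
                             functional (ps S S∈C) p′ q′
      ; injective  = λ p q → let (S , S∈C , p′ , q′) = common linear isU p q in
                             injective (ps S S∈C) p′ q′
      }

    empty : 𝒫 (A × B)
    empty _ = false

    empty-injection : PartialInjection empty
    empty-injection = record { functional = λ () ; injective = λ () }

    open Zorn PartialInjection partialInjection-chains empty empty-injection using (zorn)

    -- A maximal partial injection is total or onto: otherwise a pair missing both its domain and
    -- its range could be adjoined.
    compare : (A ↣ B) ⊎ (B ↣ A)
    compare with zorn
    ... | M , M-inj , _ , maximal with em₀ {∀ a → ∃[ b ] (a , b) ∈ᵇ M} | em₀ {∀ b → ∃[ a ] (a , b) ∈ᵇ M}
    ...   | yes total | _ = inj₁ (mk↣ {to = proj₁ ∘ total} λ {a} {a′} e →
            injective M-inj (proj₂ (total a)) (≡.subst (λ b → (a′ , b) ∈ᵇ M) (sym e) (proj₂ (total a′))))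
    ...   | no _ | yes total = inj₂ (mk↣ {to = proj₁ ∘ total} λ {b} {b′} e →
            functional M-inj (proj₂ (total b)) (≡.subst (λ a → (a , b′) ∈ᵇ M) (sym e) (proj₂ (total b′))))
    ...   | no ¬dom | no ¬ran = ⊥-elim (¬dom λ a → decidable-stable em₀ λ a∉ →
            ¬ran λ b → decidable-stable em₀ λ b∉ → b∉ (a , adjoin a b a∉ b∉))
      where
      adjoin : ∀ a b → ¬ (∃[ b′ ] (a , b′) ∈ᵇ M) → ¬ (∃[ a′ ] (a′ , b) ∈ᵇ M) → (a , b) ∈ᵇ M
      adjoin a b a∉ b∉ = maximal M′ M′-inj (λ _ → fromWitness ∘ inj₁) _ (fromWitness (inj₂ refl))
        where
        M′ : 𝒫 (A × B)
        M′ = comprehend (λ y → y ∈ᵇ M ⊎ y ≡ (a , b))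
        M′-inj : PartialInjection M′
        M′-inj = record
          { functional = λ p q → f (toWitness p) (toWitness q)
          ; injective  = λ p q → i (toWitness p) (toWitness q)
          }
          where
          f : ∀ {x y y′} → (x , y) ∈ᵇ M ⊎ (x , y) ≡ (a , b) → (x , y′) ∈ᵇ M ⊎ (x , y′) ≡ (a , b) → y ≡ y′
          f (inj₁ p) (inj₁ q) = functional M-inj p q
          f (inj₁ p) (inj₂ refl) = ⊥-elim (a∉ (_ , p))
          f (inj₂ refl) (inj₁ q) = ⊥-elim (a∉ (_ , q))
          f (inj₂ refl) (inj₂ refl) = refl
          i : ∀ {x x′ y} → (x , y) ∈ᵇ M ⊎ (x , y) ≡ (a , b) → (x′ , y) ∈ᵇ M ⊎ (x′ , y) ≡ (a , b) → x ≡ x′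
          i (inj₁ p) (inj₁ q) = injective M-inj p q
          i (inj₁ p) (inj₂ refl) = ⊥-elim (b∉ (_ , p))
          i (inj₂ refl) (inj₁ q) = ⊥-elim (b∉ (_ , q))
          i (inj₂ refl) (inj₂ refl) = refl

  -- Membership goes through `True`, whose proofs are all equal, so elements are equal as soon as
  -- their first components are.
  Subset : {X : Set} → (X → Set) → Set
  Subset P = ∃[ x ] True (em₀ {P x})

  Subset-≡ : ∀ {X} {P : X → Set} {x y : Subset P} → proj₁ x ≡ proj₁ y → x ≡ y
  Subset-≡ {x = x , p} {.x , q} refl = cong (x ,_) (T-irrelevant p q)

  -- Tarski's theorem on squares of infinite sets

  module Square {X : Set} where

    Relates : 𝒫 (X × X × X) → X → X → X → Set
    Relates G x y z = (x , y , z) ∈ᵇ G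

    -- The set on which a pairing lives, read off from the diagonal. One subset of `X × X × X` thus
    -- carries both the set and its pairing, and Zorn's lemma applies to a single powerset.
    Domain : 𝒫 (X × X × X) → X → Set
    Domain G x = ∃[ z ] Relates G x x z

    record PartialPairing (G : 𝒫 (X × X × X)) : Set where
      field
        functional : ∀ {x y z z′} → Relates G x y z → Relates G x y z′ → z ≡ z′
        injective  : ∀ {x y x′ y′ z} → Relates G x y z → Relates G x′ y′ z → (x , y) ≡ (x′ , y′)
        closed     : ∀ {x y z} → Relates G x y z → Domain G x × Domain G y × Domain G z
        total      : ∀ {x y} → Domain G x → Domain G y → ∃[ z ] Relates G x y z

    open PartialPairing

    partialPairing-chains : ChainClosed PartialPairing
    partialPairing-chains C U _ ps linear isU@(ub , lub) = record
      { functional = λ p q → let (S , S∈C , p′ , q′) = common linear isU p q in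
                             functional (ps S S∈C) p′ q′
      ; injective  = λ p q → let (S , S∈C , p′ , q′) = common linear isU p q in
                             injective (ps S S∈C) p′ q′
      ; closed     = λ p → let (S , S∈C , p′) = lub p
                               ((_ , a) , (_ , b) , (_ , c)) = closed (ps S S∈C) p′
                           in (_ , ub S S∈C _ a) , (_ , ub S S∈C _ b) , (_ , ub S S∈C _ c)
      ; total      = λ (_ , p) (_ , q) → let (S , S∈C , p′ , q′) = common linear isU p q
                                             (z , r) = total (ps S S∈C) (_ , p′) (_ , q′)
                                         in z , ub S S∈C _ r
      }

    module _ {W : Set} (emb : W ↣ X) (q : (W × W) ↣ W) where
      open Injection emb using () renaming (to to e; injective to e-injective)
      open Injection q using () renaming (to to pair; injective to pair-injective)

      -- The pairing of `W` transported to `X`. For `W = ℕ` it starts Zorn's lemma; for two copies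
      -- of a domain it is the extension that contradicts maximality.
      graph : 𝒫 (X × X × X)
      graph = comprehend λ (x , y , z) → ∃[ v ] ∃[ w ] x ≡ e v × y ≡ e w × z ≡ e (pair (v , w))

      ∈-graph : ∀ v w → Relates graph (e v) (e w) (e (pair (v , w)))
      ∈-graph v w = fromWitness (v , w , refl , refl , refl)

      ∈-domain : ∀ v → Domain graph (e v)
      ∈-domain v = _ , ∈-graph v v

      graph-pairing : PartialPairing graph
      graph-pairing = record
        { functional = λ p q → graph-functional (toWitness p) (toWitness q)
        ; injective  = λ p q → graph-injective (toWitness p) (toWitness q)
        ; closed     = λ p → graph-closed (toWitness p)
        ; total      = λ (_ , p) (_ , q) → graph-total (toWitness p) (toWitness q)
        }
        where
        G : X → X → X → Set
        G x y z = ∃[ v ] ∃[ w ] x ≡ e v × y ≡ e w × z ≡ e (pair (v , w))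
        graph-functional : ∀ {x y z z′} → G x y z → G x y z′ → z ≡ z′
        graph-functional (v , w , refl , refl , refl) (v′ , w′ , p , p′ , refl) =
          cong₂ (λ v w → e (pair (v , w))) (e-injective p) (e-injective p′)
        graph-injective : ∀ {x y x′ y′ z} → G x y z → G x′ y′ z → (x , y) ≡ (x′ , y′)
        graph-injective (v , w , refl , refl , refl) (v′ , w′ , refl , refl , p)
          with refl ← pair-injective (e-injective p) = refl
        graph-closed : ∀ {x y z} → G x y z → Domain graph x × Domain graph y × Domain graph z
        graph-closed (v , w , refl , refl , refl) = ∈-domain v , ∈-domain w , ∈-domain (pair (v , w))
        graph-total : ∀ {x y z z′} → G x x z → G y y z′ → ∃[ z″ ] Relates graph x y z″
        graph-total (v , _ , refl , _) (w , _ , refl , _) = _ , ∈-graph v w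

    module Maximal (ι : ℕ ↣ X) (M : 𝒫 (X × X × X)) (M-pairing : PartialPairing M)
                   (base⊑M : graph ι ℕ-pairing ⊑ M) (M-maximal : MaximalIn PartialPairing M) where
      open Injection ι using () renaming (to to i; injective to i-injective)

      In Out : Set
      In = Subset (Domain M)
      Out = Subset (λ x → ¬ Domain M x)

      p : In × In → In
      p ((x , x∈) , (y , y∈)) = let (z , r) = total M-pairing (toWitness x∈) (toWitness y∈) in
        z , fromWitness (proj₂ (proj₂ (closed M-pairing r)))

      p-relates : ∀ a b → Relates M (proj₁ a) (proj₁ b) (proj₁ (p (a , b)))
      p-relates (x , x∈) (y , y∈) = proj₂ (total M-pairing (toWitness x∈) (toWitness y∈))

      p-injective : ∀ {a b} → p a ≡ p b → a ≡ b
      p-injective {a , b} {a′ , b′} e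
        with e′ ← injective M-pairing (p-relates a b)
                    (≡.subst (Relates M _ _) (sym (cong proj₁ e)) (p-relates a′ b′))
        = cong₂ _,_ (Subset-≡ (cong proj₁ e′)) (Subset-≡ (cong proj₂ e′))

      number : ℕ → In
      number n = i n , fromWitness (_ , base⊑M _ (proj₂ (∈-domain ι ℕ-pairing n)))

      -- The domain contains the images of 0 and 1, which tag the two summands; the pairing then
      -- absorbs the tag.
      In-double : (In ⊎ In) ↣ In
      In-double = mk↣ {to = u} λ {a} {b} → u-injective {a} {b}
        where
        u : In ⊎ In → In
        u (inj₁ a) = p (number 0 , a)
        u (inj₂ a) = p (number 1 , a)
        0≢1 : number 0 ≢ number 1
        0≢1 e with () ← i-injective (cong proj₁ e)
        u-injective : ∀ {a b} → u a ≡ u b → a ≡ b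
        u-injective {inj₁ a} {inj₁ b} e = cong (inj₁ ∘ proj₂) (p-injective e)
        u-injective {inj₁ a} {inj₂ b} e = contradiction (cong proj₁ (p-injective e)) 0≢1
        u-injective {inj₂ a} {inj₁ b} e = contradiction (sym (cong proj₁ (p-injective e))) 0≢1
        u-injective {inj₂ a} {inj₂ b} e = cong (inj₂ ∘ proj₂) (p-injective e)

      open Injection In-double using () renaming (to to u; injective to u-injective)

      -- A copy of the domain of M outside it makes room to extend the pairing M
      -- to both copies.
      In⋠Out : ¬ (In ↣ Out)
      -- The element `J (number 0)` lies outside the domain of `M`, yet in that of the extended
      -- pairing, which maximality places inside `M`.
      In⋠Out j = toWitness (proj₂ (J (number 0)))
        (_ , M-maximal (graph emb q) (graph-pairing emb q) M⊑ _
               (proj₂ (∈-domain emb q (inj₂ (number 0)))))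
        where
        open Injection j using () renaming (to to J; injective to J-injective)

        to-X : In ⊎ In → X
        to-X = [ proj₁ , proj₁ ∘ J ]′

        to-X-injective : ∀ {a b} → to-X a ≡ to-X b → a ≡ b
        to-X-injective {inj₁ a} {inj₁ b} e = cong inj₁ (Subset-≡ e)
        to-X-injective {inj₁ a} {inj₂ b} e = contradiction
          (≡.subst (Domain M) e (toWitness (proj₂ a))) (toWitness (proj₂ (J b)))
        to-X-injective {inj₂ a} {inj₁ b} e = contradiction
          (≡.subst (Domain M) (sym e) (toWitness (proj₂ b))) (toWitness (proj₂ (J a)))
        to-X-injective {inj₂ a} {inj₂ b} e = cong inj₂ (J-injective (Subset-≡ e))

        emb : (In ⊎ In) ↣ X
        emb = mk↣ {to = to-X} to-X-injective

        -- Pairs within the first copy keep their old value, so `M` is extended. All other pairs are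
        -- squeezed by `u` into pairs of `In` and sent to the second copy, away from the old values.
        pair : (In ⊎ In) × (In ⊎ In) → In ⊎ In
        pair (inj₁ a , inj₁ b) = inj₁ (p (a , b))
        pair (inj₁ a , inj₂ b) = inj₂ (p (u (inj₁ a) , u (inj₂ b)))
        pair (inj₂ a , b)      = inj₂ (p (u (inj₂ a) , u b))

        uu-injective : ∀ {a b a′ b′} → inj₂ {A = In} (p (u a , u b)) ≡ inj₂ (p (u a′ , u b′)) →
                       (a , b) ≡ (a′ , b′)
        uu-injective e with e′ ← p-injective (inj₂-injective e) =
          cong₂ _,_ (u-injective (cong proj₁ e′)) (u-injective (cong proj₂ e′))

        pair-injective : ∀ {a b} → pair a ≡ pair b → a ≡ b
        pair-injective {inj₁ a , inj₁ b} {inj₁ a′ , inj₁ b′} e =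
          cong (λ (a , b) → inj₁ a , inj₁ b) (p-injective (inj₁-injective e))
        pair-injective {inj₁ a , inj₂ b} {inj₁ a′ , inj₂ b′} e = uu-injective e
        pair-injective {inj₁ a , inj₂ b} {inj₂ a′ , b′}      e = uu-injective e
        pair-injective {inj₂ a , b}      {inj₁ a′ , inj₂ b′} e = uu-injective e
        pair-injective {inj₂ a , b}      {inj₂ a′ , b′}      e = uu-injective e

        q : ((In ⊎ In) × (In ⊎ In)) ↣ (In ⊎ In)
        q = mk↣ {to = pair} pair-injective

        M⊑ : M ⊑ graph emb q
        M⊑ (x , y , z) r with closed M-pairing r
        ... | x∈ , y∈ , _ = fromWitness
          ( inj₁ (x , fromWitness x∈) , inj₁ (y , fromWitness y∈) , refl , refl
          , functional M-pairing r (p-relates _ _))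

      -- In the remaining case `X` splits into `In` and a set embedded in `In`; by `u` all of `X`
      -- embeds in `In`, and the pairing of `In` pulls back to `X`.
      conclusion : (In ↣ Out) ⊎ (Out ↣ In) → (X × X) ↣ X
      conclusion (inj₁ j) = contradiction j In⋠Out
      conclusion (inj₂ j) = mk↣ {to = λ (x , y) → proj₁ (p (s x , s y))} λ e →
        let e′ = p-injective (Subset-≡ e) in
        cong₂ _,_ (s-injective (cong proj₁ e′)) (s-injective (cong proj₂ e′))
        where
        open Injection j using () renaming (to to J; injective to J-injective)

        split : (x : X) → Dec (Domain M x) → In ⊎ In
        split x (yes x∈) = inj₁ (x , fromWitness x∈)
        split x (no x∉)  = inj₂ (J (x , fromWitness x∉))

        split-injective : ∀ {x y} d d′ → split x d ≡ split y d′ → x ≡ y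
        split-injective (yes _) (yes _) e = cong proj₁ (inj₁-injective e)
        split-injective (no _)  (no _)  e = cong proj₁ (J-injective (inj₂-injective e))

        s : X → In
        s x = u (split x em₀)

        s-injective : ∀ {x y} → s x ≡ s y → x ≡ y
        s-injective {x} {y} e = split-injective em₀ em₀ (u-injective e)

    square : ℕ ↣ X → (X × X) ↣ X
    square ι with Zorn.zorn PartialPairing partialPairing-chains
                    (graph ι ℕ-pairing) (graph-pairing ι ℕ-pairing)
    ... | M , M-pairing , base⊑M , M-maximal =
      Maximal.conclusion ι M M-pairing base⊑M M-maximal compare

  -- Counting trees and quotients

  Tree↣ : {X : Set} → ℕ ↣ X → Tree X ↣ X
  Tree↣ {X} ι = mk↣ {to = code} code-injective
    where
    open Injection ι using () renaming (to to i; injective to i-injective)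
    open Injection (Square.square ι) using () renaming (to to pair; injective to pair-injective)

    0≢1 : i 0 ≢ i 1
    0≢1 e with () ← i-injective e

    code : Tree X → X
    code (leaf x)   = pair (i 0 , x)
    code (node l r) = pair (i 1 , pair (code l , code r))

    code-injective : ∀ {s t} → code s ≡ code t → s ≡ t
    code-injective {leaf x} {leaf y} e = cong leaf (cong proj₂ (pair-injective e))
    code-injective {leaf x} {node _ _} e = contradiction (cong proj₁ (pair-injective e)) 0≢1
    code-injective {node _ _} {leaf y} e = contradiction (sym (cong proj₁ (pair-injective e))) 0≢1
    code-injective {node l r} {node l′ r′} e =
      let e′ = pair-injective (cong proj₂ (pair-injective e)) in
      cong₂ node (code-injective (cong proj₁ e′)) (code-injective (cong proj₂ e′))

  module Representatives (X : Setoid 0ℓ 0ℓ) where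
    open Setoid X using (_≈_) renaming (Carrier to C; refl to ≈-refl; sym to ≈-sym; trans to ≈-trans)

    -- The relation to be uniformised is the equality of `X` itself. Since the function obtained
    -- sends equal elements to identical ones, it selects one representative from each class.
    choice : Σ[ r ∈ Func X (≡.setoid C) ] (∀ x → x ≈ Func.to r x)
    choice = ac X (≡.setoid C) _≈_ (λ { p refl q → ≈-trans (≈-sym p) q }) (λ x → x , ≈-refl)

    rep : C → C
    rep = Func.to (proj₁ choice)

    rep-≈ : ∀ x → x ≈ rep x
    rep-≈ = proj₂ choice

    rep-cong : ∀ {x y} → x ≈ y → rep x ≡ rep y
    rep-cong = Func.cong (proj₁ choice)

    rep-injection : X ≤ᶜ ≡.setoid C
    rep-injection = record
      { to        = rep
      ; cong      = rep-cong
      ; injective = λ {x} {y} e → ≈-trans (≡.subst (x ≈_) e (rep-≈ x)) (≈-sym (rep-≈ y))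
      }

    Rep : Set
    Rep = ∃[ x ] rep x ≡ x

    Rep-injection : ≡.setoid Rep ≤ᶜ X
    Rep-injection = record
      { to        = proj₁
      ; cong      = λ { refl → ≈-refl }
      ; injective = λ { {x , e} {y , e′} x≈y → Rep-≡ e e′ (trans (sym e) (trans (rep-cong x≈y) e′)) }
      }
      where
      Rep-≡ : ∀ {x y} (e : rep x ≡ x) (e′ : rep y ≡ y) → x ≡ y → _≡_ {A = Rep} (x , e) (y , e′)
      Rep-≡ e e′ refl = cong (_ ,_) (uip e e′)

    toRep : C → Rep
    toRep x = rep x , rep-cong (≈-sym (rep-≈ x))

  -- Representatives of the classes of X turn it into a type under propositional
  -- equality, to which Tree↣ applies.
  tree-bound : (X : Setoid 0ℓ 0ℓ) → ≡.setoid ℕ ≤ᶜ X →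
               (≡.setoid (Tree (Representatives.Rep X))) ≤ᶜ X
  tree-bound X ι = Composition.injection (Tree↣ (mk↣ {to = toRep ∘ i} λ {m} {n} e → i-injective
      (≈-trans (rep-≈ (i m)) (≡.subst (λ z → proj₁ z ≈ i n) (sym e) (≈-sym (rep-≈ (i n))))))) Rep-injection
    where
    open Representatives X
    open Setoid X using (_≈_) renaming (sym to ≈-sym; trans to ≈-trans)
    open Injection ι using () renaming (to to i; injective to i-injective)

  -- Representatives embed `Q` in its own carrier; thus a bound on the number of trees bounds a
  -- universe in which many trees denote the same element.
  quotient-bound : (Q : Setoid 0ℓ 0ℓ) {X : Setoid 0ℓ 0ℓ} → ≡.setoid (Setoid.Carrier Q) ≤ᶜ X → Q ≤ᶜ X
  quotient-bound Q = Composition.injection (Representatives.rep-injection Q)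

-- Elementary substructures

private
  variable
    a b c : Level
    A : Set a
    B : Set b
    C : Set c
    m n : ℕ

module _ (f : A → V) (g : B → V) where

  Agree : Vec A m → Vec B n → Set _
  Agree = Pointwise (λ x y → f x ≐ g y)

  agree-sym : {xs : Vec A m} {ys : Vec B n} → Agree xs ys →
              Pointwise (λ y x → g y ≐ f x) ys xs
  agree-sym = Pointwise.sym (λ {x} {y} → ≐-sym (f x) (g y))

  agree-trans : (h : C → V) {k : ℕ} {xs : Vec A m} {ys : Vec B n} {zs : Vec C k} →
                Agree xs ys → Pointwise (λ y z → g y ≐ h z) ys zs → Pointwise (λ x z → f x ≐ h z) xs zs
  agree-trans h = Pointwise.trans (λ {x} {y} {z} → ≐-trans (f x) (g y) (h z))

names : (a : V) (xs : Vec (El a) n) → Names a xs (map (name a) xs)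
names a []       = []
names a (x ∷ xs) = ≐-refl (name a x) ∷ names a xs

choose : ∀ {ℓ} {R : A → B → Set ℓ} → (∀ x → ∃[ y ] R x y) →
         (xs : Vec A n) → Σ[ ys ∈ Vec B n ] Pointwise R xs ys
choose f []       = [] , []
choose f (x ∷ xs) = let (y , r) = f x; (ys , rs) = choose f xs in y ∷ ys , r ∷ rs

map-pointwise : ∀ {ℓ} {R : B → C → Set ℓ} {f : A → B} {xs : Vec A m} {ys : Vec C n} →
                Pointwise (λ x y → R (f x) y) xs ys → Pointwise R (map f xs) ys
map-pointwise []       = []
map-pointwise (r ∷ rs) = r ∷ map-pointwise rs

pointwise-map : ∀ {ℓ} {R : A → B → Set ℓ} {f : A → B} (xs : Vec A n) →
                (∀ x → R x (f x)) → Pointwise R xs (map f xs)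
pointwise-map []       r = []
pointwise-map (x ∷ xs) r = r x ∷ pointwise-map xs r

∈⇒image : ∀ a b → a ⊆ b → ∀ x → ∃[ y ] name a x ≐ name b y
∈⇒image a b a⊆b x = let (y , e) = a⊆b (name a x) (x , ≐-refl (name a x)) in
  y , ≐-sym (name b y) (name a x) e

image⇒⊆ : ∀ a b → (∀ x → ∃[ y ] name a x ≐ name b y) → a ⊆ b
image⇒⊆ a b f v (x , e) = let (y , e′) = f x in
  y , ≐-trans (name b y) (name a x) v (≐-sym (name a x) (name b y) e′) e

-- A fragment lists its formulas only up to `≋`. This carries truth between a formula and its code
-- when Skolem functions are built from codes.
⊨-≋ : ∀ {L Λ} (M : Structure L) {n} (φ χ : Formula L Λ n) → φ ≋ χ → ∀ xs → M ⊨ φ [ xs ] ⇔ M ⊨ χ [ xs ]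
⊨-≋ M (equ _ _) (equ _ _) (refl , refl) xs = Identity.⇔-id _
⊨-≋ M (pred _ _) (pred _ _) refl xs = Identity.⇔-id _
⊨-≋ M (neg φ) (neg χ) e xs = mk⇔ (_∘ from (⊨-≋ M φ χ e xs)) (_∘ to (⊨-≋ M φ χ e xs))
⊨-≋ M (⋀ I _ φ) (⋀ J _ χ) (p , q) xs = mk⇔
  (λ h j → to (⊨-≋ M (φ _) (χ j) (proj₂ (q j)) xs) (h _))
  (λ h i → from (⊨-≋ M (φ i) (χ _) (proj₂ (p i)) xs) (h _))
⊨-≋ M (⋁ I _ φ) (⋁ J _ χ) (p , q) xs = mk⇔
  (λ (i , h) → _ , to (⊨-≋ M (φ i) (χ _) (proj₂ (p i)) xs) h)
  (λ (j , h) → _ , from (⊨-≋ M (φ _) (χ j) (proj₂ (q j)) xs) h)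
⊨-≋ M (all φ) (all χ) e xs = mk⇔
  (λ h x → to (⊨-≋ M φ χ e (x ∷ xs)) (h x)) (λ h x → from (⊨-≋ M φ χ e (x ∷ xs)) (h x))
⊨-≋ M (ex φ) (ex χ) e xs = mk⇔
  (λ (x , h) → x , to (⊨-≋ M φ χ e (x ∷ xs)) h) (λ (x , h) → x , from (⊨-≋ M φ χ e (x ∷ xs)) h)

vars : ∀ {L} → (Fin m → Fin n) → Vec (Term L n) m
vars ρ = tabulate (var ∘ ρ)

evals-vars : ∀ {L} (M : Structure L) (xs : Vec (Carrier M) n) (ρ : Fin m → Fin n) →
             evals M xs (vars ρ) ≡ tabulate (lookup xs ∘ ρ)
evals-vars {m = zero}  M xs ρ = refl
evals-vars {m = suc m} M xs ρ = cong (lookup xs (ρ zero) ∷_) (evals-vars M xs (ρ ∘ suc))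

evals-identity : ∀ {L} (M : Structure L) (xs : Vec (Carrier M) n) → evals M xs (vars id) ≡ xs
evals-identity M xs = ≡.trans (evals-vars M xs id) (tabulate∘lookup xs)

evals-tail : ∀ {L} (M : Structure L) x (xs : Vec (Carrier M) n) → evals M (x ∷ xs) (vars suc) ≡ xs
evals-tail M x xs = ≡.trans (evals-vars M (x ∷ xs) suc) (tabulate∘lookup xs)

-- Variable 0 is the value and the later variables are the arguments. Being atomic, the formula lies
-- in every fragment, which brings the operations under the control of elementarity.
graphFormula : ∀ {L Λ} (f : Fun L) → Formula L Λ (suc (arity L f))
graphFormula f = equ (var zero) (app f (vars suc))

graphFormula-⊨ : ∀ {L Λ} (M : Structure L) f x xs →
                 (M ⊨ graphFormula {L} {Λ} f [ x ∷ xs ]) ≡ Structure._≈_ M x (fun M f xs)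
graphFormula-⊨ M f x xs = cong (λ ys → Structure._≈_ M x (fun M f ys)) (evals-tail M x xs)

-- An embedding given as a relation, mostly agreement of names: one set may be named by several
-- indices on either side.
record Embeds {L} (M N : Structure L) (ρ : Carrier M → Carrier N → Set) : Set where
  open Structure M using () renaming (_≈_ to _≈ᴹ_)
  open Structure N using () renaming (_≈_ to _≈ᴺ_)
  field
    total     : ∀ x → ∃[ y ] ρ x y
    related-≈ : ∀ {x x′ y y′} → ρ x y → ρ x′ y′ → x ≈ᴹ x′ ⇔ y ≈ᴺ y′
    related-fun : ∀ f {xs ys} → Pointwise ρ xs ys → ρ (fun M f xs) (fun N f ys)
    related-rel : ∀ R {xs ys} → Pointwise ρ xs ys → rel M R xs ⇔ rel N R ys

  mutual
    related-eval : ∀ {n} {xs : Vec _ n} {ys} → Pointwise ρ xs ys → ∀ t → ρ (eval M xs t) (eval N ys t)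
    related-eval rs (var i)    = Pointwise.lookup rs i
    related-eval rs (app f ts) = related-fun f (related-evals rs ts)

    related-evals : ∀ {n k} {xs : Vec _ n} {ys} → Pointwise ρ xs ys → (ts : Vec (Term L n) k) →
                    Pointwise ρ (evals M xs ts) (evals N ys ts)
    related-evals rs []       = []
    related-evals rs (t ∷ ts) = related-eval rs t ∷ related-evals rs ts

module ModelTheory (em₀ : ExcludedMiddle 0ℓ) {L : Signature} {Λ : Setoid 0ℓ 0ℓ} (𝔸 : Fragment L Λ) where
  open Fragment 𝔸

  Preserved : (M N : Structure L) → (Carrier M → Carrier N → Set) → Formula L Λ n → Set
  Preserved M N ρ φ = ∀ {xs ys} → Pointwise ρ xs ys → M ⊨ φ [ xs ] ⇔ N ⊨ φ [ ys ]

  -- A family of structures is needed for unions of chains: the quantifier step for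
  -- one member of the chain uses the induction hypothesis for the others.
  tarskiVaught :
    {I : Set} (M : I → Structure L) (N : Structure L) (ρ : ∀ i → Carrier (M i) → Carrier N → Set) →
    (∀ i → Embeds (M i) N (ρ i)) →
    (∀ {n} {φ : Formula L Λ (suc n)} → φ ∈ᶠ 𝔸 → (∀ i → Preserved (M i) N (ρ i) φ) →
       ∀ i {xs ys} → Pointwise (ρ i) xs ys → ∀ y → N ⊨ φ [ y ∷ ys ] → ∃[ x ] M i ⊨ φ [ x ∷ xs ]) →
    ∀ {n} (φ : Formula L Λ n) → φ ∈ᶠ 𝔸 → ∀ i → Preserved (M i) N (ρ i) φ
  tarskiVaught M N ρ embeds witness = go
    where
    open module E i = Embeds (embeds i)

    neg-preserved : ∀ {n} {φ : Formula L Λ n} → (∀ i → Preserved (M i) N (ρ i) φ) →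
                    ∀ i → Preserved (M i) N (ρ i) (neg φ)
    neg-preserved ih i rs = mk⇔ (_∘ from (ih i rs)) (_∘ to (ih i rs))

    go : ∀ {n} (φ : Formula L Λ n) → φ ∈ᶠ 𝔸 → ∀ i → Preserved (M i) N (ρ i) φ
    go (equ t u) _ i rs = related-≈ i (related-eval i rs t) (related-eval i rs u)
    go (pred R ts) _ i rs = related-rel i R (related-evals i rs ts)
    go (neg φ) φ∈ i = neg-preserved {φ = φ} (go φ (neg-sub φ∈)) i
    go (⋀ I _ φ) φ∈ i rs = mk⇔
      (λ h j → to (go (φ j) (⋀-sub φ∈ j) i rs) (h j))
      (λ h j → from (go (φ j) (⋀-sub φ∈ j) i rs) (h j))
    go (⋁ I _ φ) φ∈ i rs = mk⇔
      (λ (j , h) → j , to (go (φ j) (⋁-sub φ∈ j) i rs) h)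
      (λ (j , h) → j , from (go (φ j) (⋁-sub φ∈ j) i rs) h)
    go (all φ) ∀φ∈ i {xs} {ys} rs = mk⇔
      -- The witness condition is used for `neg φ`, which is again in the fragment: a counterexample
      -- in `N` would produce one in `M i`.
      (λ h y → decidable-stable em₀ λ ¬φ →
        let (x , ¬φ′) = witness (neg∈ φ∈) (neg-preserved {φ = φ} ih) i rs y ¬φ in ¬φ′ (h x))
      (λ h x → let (y , r) = total i x in from (ih i (r ∷ rs)) (h y))
      where
      φ∈ = all-sub ∀φ∈
      ih = go φ φ∈
    go (ex φ) ∃φ∈ i rs = mk⇔
      (λ (x , h) → let (y , r) = total i x in y , to (ih i (r ∷ rs)) h)
      (λ (y , h) → witness φ∈ ih i rs y h)
      where
      φ∈ = ex-sub ∃φ∈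
      ih = go φ φ∈

  -- Tarski-Vaught for a one-member family, where surjectivity supplies the witness. Relating `x` to
  -- every `y` equal to its image also covers change of names; for the identity map this gives
  -- reflexivity of `≼`.
  isomorphism-⊨ : ∀ {M N : Structure L} (f : Isomorphism M N) {n} (φ : Formula L Λ n) → φ ∈ᶠ 𝔸 →
                  Preserved M N (λ x y → Structure._≈_ N (Isomorphism.to f x) y) φ
  isomorphism-⊨ {M} {N} f φ φ∈ = tarskiVaught {I = ⊤} (λ _ → M) N (λ _ → ρ) (λ _ → embeds)
    (λ _ ih i rs y h → let (x , r) = surj y in x , from (ih tt (r ∷ rs)) h) φ φ∈ tt
    where
    open Isomorphism f using (bijection; fun-homo; rel-homo) renaming (to to f₀)
    open Setoid ⟪ dom N ⟫ using (_≈_) renaming (refl to ≈-refl; sym to ≈-sym; trans to ≈-trans)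
    ρ : Carrier M → Carrier N → Set
    ρ x y = f₀ x ≈ y
    surj : ∀ y → ∃[ x ] ρ x y
    surj y = let (x , e) = Bijection.surjective bijection y in x , e (Setoid.refl ⟪ dom M ⟫ {x})
    embeds : Embeds M N ρ
    embeds = record
      { total     = λ x → f₀ x , ≈-refl {f₀ x}
      ; related-≈ = λ {x} {x′} {y} {y′} r r′ → mk⇔
          (λ e → ≈-trans {y} {f₀ x} {y′} (≈-sym {f₀ x} {y} r)
                   (≈-trans {f₀ x} {f₀ x′} {y′} (Bijection.cong bijection e) r′))
          (λ e → Bijection.injective bijection
                   (≈-trans {f₀ x} {y} {f₀ x′} r (≈-trans {y} {y′} {f₀ x′} e (≈-sym {f₀ x′} {y′} r′))))
      ; related-fun = λ g {xs} {ys} rs → ≈-trans {f₀ (fun M g xs)} {fun N g (map f₀ xs)} {fun N g ys}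
          (fun-homo g xs) (fun-cong N g (map-pointwise rs))
      ; related-rel = λ R {xs} {ys} rs → mk⇔
          (λ h → rel-cong N R (map-pointwise rs) (to (rel-homo R xs) h))
          (λ h → from (rel-homo R xs) (rel-cong N R
                   (Pointwise.sym (λ {x} {y} → ≈-sym {x} {y}) (map-pointwise rs)) h))
      }

  identity : (M : Structure L) → Isomorphism M M
  identity M = record
    { bijection = Identity.bijection ⟪ dom M ⟫
    ; fun-homo  = λ f xs → ≡.subst (λ ys → Structure._≈_ M (fun M f xs) (fun M f ys))
                             (≡.sym (map-id xs)) (≐-refl (name (dom M) (fun M f xs)))
    ; rel-homo  = λ R xs → ≡.subst (λ ys → rel M R xs ⇔ rel M R ys) (≡.sym (map-id xs)) (Identity.⇔-id _)
    }

  infix 4 _≼_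
  _≼_ : Structure L → Structure L → Set₁
  M ≼ N = ElementarySubstructure 𝔸 M N

  Elementary : Structure L → Structure L → Set₁
  Elementary M N = ∀ {n} (φ : Formula L Λ n) → φ ∈ᶠ 𝔸 → ∀ xs ys →
    Pointwise (λ x y → name (dom M) x ≐ name (dom N) y) xs ys → M ⊨ φ [ xs ] ⇔ N ⊨ φ [ ys ]

  module _ {M N : Structure L} (M⊆N : dom M ⊆ dom N) (elementary : Elementary M N) where
    private
      μ = name (dom M)
      ν = name (dom N)

    -- Let `y` be the element of `N` with the name of `fun M f xs`. The graph formula of `f` holds
    -- in `M` at that value, hence in `N` at `y`.
    elementary⇒fun : ∀ f {xs ys} → Pointwise (λ x y → μ x ≐ ν y) xs ys → μ (fun M f xs) ≐ ν (fun N f ys)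
    elementary⇒fun f {xs} {ys} rs = ≐-trans (μ (fun M f xs)) (ν y) (ν (fun N f ys)) e
      (≡.subst id (graphFormula-⊨ {Λ = Λ} N f y ys)
        (to (elementary (graphFormula f) (equ∈ _ _) (fun M f xs ∷ xs) (y ∷ ys) (e ∷ rs))
          (≡.subst id (≡.sym (graphFormula-⊨ {Λ = Λ} M f (fun M f xs) xs)) (≐-refl (μ (fun M f xs))))))
      where
      image = ∈⇒image (dom M) (dom N) M⊆N (fun M f xs)
      y = proj₁ image
      e = proj₂ image

    elementary⇒rel : ∀ R {xs ys} → Pointwise (λ x y → μ x ≐ ν y) xs ys → rel M R xs ⇔ rel N R ys
    elementary⇒rel R {xs} {ys} rs =
      ≡.subst₂ (λ us vs → rel M R us ⇔ rel N R vs) (evals-identity M xs) (evals-identity N ys)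
        (elementary (pred R (vars id)) (pred∈ _ _) xs ys rs)

    -- Atomic formulas belong to the fragment, so elementarity already makes the operations and
    -- relations agree.
    elementary⇒≼ : M ≼ N
    elementary⇒≼ = record
      { isSubstructure = record
        { sub-dom = M⊆N
        ; sub-fun = λ f vs w (xs , xs≐vs , e) →
            let (ys , rs) = choose (∈⇒image (dom M) (dom N) M⊆N) xs in
            ys , agree-trans ν μ id (agree-sym μ ν rs) xs≐vs ,
            ≐-trans (ν (fun N f ys)) (μ (fun M f xs)) w
              (≐-sym (μ (fun M f xs)) (ν (fun N f ys)) (elementary⇒fun f rs)) e
        ; sub-rel = λ R vs vs∈M → mk⇔
            (λ (xs , xs≐vs , h) → let (ys , rs) = choose (∈⇒image (dom M) (dom N) M⊆N) xs in
              ys , agree-trans ν μ id (agree-sym μ ν rs) xs≐vs , to (elementary⇒rel R rs) h)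
            (λ (ys , ys≐vs , h) → let (xs , xs≐vs) = members vs∈M in
              xs , xs≐vs , from (elementary⇒rel R (agree-trans μ id ν xs≐vs (agree-sym ν id ys≐vs))) h)
        }
      ; elementary = elementary
      }
      where
      members : ∀ {n} {vs : Vec V n} → All (_∈ dom M) vs → ∃[ xs ] Names (dom M) xs vs
      members []             = [] , []
      members ((x , e) ∷ ps) = let (xs , es) = members ps in x ∷ xs , e ∷ es

  open ElementarySubstructure

  ≼⇒⊆ : ∀ {M N} → M ≼ N → dom M ⊆ dom N
  ≼⇒⊆ = Substructure.sub-dom ∘ isSubstructure

  ≼-refl : ∀ M → M ≼ M
  ≼-refl M = elementary⇒≼ (λ _ → id) (λ φ φ∈ xs ys → isomorphism-⊨ (identity M) φ φ∈)

  ≼-trans : ∀ {M N P} → M ≼ N → N ≼ P → M ≼ P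
  ≼-trans {M} {N} {P} p q = elementary⇒≼ (λ v → ≼⇒⊆ q v ∘ ≼⇒⊆ p v) λ φ φ∈ xs zs rs →
    let (ys , ss) = choose (∈⇒image (dom M) (dom N) (≼⇒⊆ p)) xs in
    elementary q φ φ∈ ys zs (agree-trans _ (name (dom M)) _ (agree-sym (name (dom M)) (name (dom N)) ss) rs)
      ⇔-∘ elementary p φ φ∈ xs ys ss

  ≼-coherent : ∀ {M N P} → M ≼ P → N ≼ P → Substructure M N → M ≼ N
  ≼-coherent {M} {N} {P} p q sub = record
    { isSubstructure = sub
    ; elementary = λ φ φ∈ xs ys rs → let (zs , ss) = choose (∈⇒image (dom N) (dom P) (≼⇒⊆ q)) ys in
        ⇔-sym (elementary q φ φ∈ ys zs ss) ⇔-∘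
        elementary p φ φ∈ xs zs (agree-trans (name (dom M)) (name (dom N)) (name (dom P)) rs ss)
    }

  -- Truth travels from `N₀` back to `M₀`, up to `M₁` and on to `N₁`; that `f₁` extends `f₀` ensures
  -- that the tuple reached has the same names as the initial one.
  ≼-isomorphism : ∀ {M₀ N₀ M₁ N₁} (f₀ : Isomorphism M₀ N₀) (f₁ : Isomorphism M₁ N₁) →
                  M₀ ≼ M₁ → f₀ extendedBy f₁ → N₀ ≼ N₁
  ≼-isomorphism {M₀} {N₀} {M₁} {N₁} f₀ f₁ p ext = elementary⇒≼
    (image⇒⊆ (dom N₀) (dom N₁) λ y → let (x , e) = preimage y; (x′ , _ , e′) = ext x in
      Isomorphism.to f₁ x′ , ≐-trans (ν₀ y) (ν₀ (to₀ x)) (ν₁ (to₁ x′)) (≐-sym (ν₀ (to₀ x)) (ν₀ y) e) e′)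
    λ φ φ∈ ys zs rs →
      let (xs , ss)  = choose preimage′ ys
          (xs′ , ts) = choose ext xs
          ss′ = agree-sym ν₀ (ν₀ ∘ to₀) ss
      in isomorphism-⊨ f₁ φ φ∈
           (agree-trans (ν₁ ∘ to₁) (ν₀ ∘ to₀) ν₁
             (agree-sym (ν₀ ∘ to₀) (ν₁ ∘ to₁) (Pointwise.map proj₂ ts))
             (agree-trans (ν₀ ∘ to₀) ν₀ ν₁ ss′ rs))
         ⇔-∘ (elementary p φ φ∈ xs xs′ (Pointwise.map proj₁ ts)
         ⇔-∘ ⇔-sym (isomorphism-⊨ f₀ φ φ∈ ss′))
    where
    ν₀ = name (dom N₀)
    ν₁ = name (dom N₁)
    to₀ = Isomorphism.to f₀
    to₁ = Isomorphism.to f₁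
    preimage : ∀ y → ∃[ x ] ν₀ (to₀ x) ≐ ν₀ y
    preimage y = let (x , e) = Bijection.surjective (Isomorphism.bijection f₀) y in
      x , e (≐-refl (name (dom M₀) x))
    preimage′ : ∀ y → ∃[ x ] ν₀ y ≐ ν₀ (to₀ x)
    preimage′ y = let (x , e) = preimage y in x , ≐-sym (ν₀ (to₀ x)) (ν₀ y) e

  -- Unions of directed families

  module DirectedUnion {I : Set} (A : I → Structure L) (i₀ : I)
                       (directed : ∀ i j → ∃[ k ] A i ≼ A k × A j ≼ A k) where
    private
      α : ∀ i → Carrier (A i) → V
      α i = name (dom (A i))

    move : ∀ {i k} → A i ≼ A k → ∀ x → ∃[ y ] α i x ≐ α k y
    move {i} {k} p = ∈⇒image (dom (A i)) (dom (A k)) (≼⇒⊆ p)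

    module _ {i j k} (p : A i ≼ A k) (q : A j ≼ A k)
             {xs : Vec (Carrier (A i)) m} {ys : Vec (Carrier (A j)) n}
             (rs : Agree (α i) (α j) xs ys) where

      move-both : Σ[ zs ∈ Vec (Carrier (A k)) m ] Agree (α i) (α k) xs zs × Agree (α j) (α k) ys zs
      move-both = let (zs , ss) = choose (move p) xs in
        zs , ss , agree-trans (α j) (α i) (α k) (agree-sym (α i) (α j) rs) ss

    agree-fun : ∀ {i j} f {xs ys} → Agree (α i) (α j) xs ys → α i (fun (A i) f xs) ≐ α j (fun (A j) f ys)
    agree-fun {i} {j} f {xs} {ys} rs with directed i j
    ... | k , p , q with move-both p q rs
    ...   | zs , ss , ts = ≐-trans (α i (fun (A i) f xs)) (α k (fun (A k) f zs)) (α j (fun (A j) f ys))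
      (elementary⇒fun (≼⇒⊆ p) (elementary p) f ss)
      (≐-sym (α j (fun (A j) f ys)) (α k (fun (A k) f zs)) (elementary⇒fun (≼⇒⊆ q) (elementary q) f ts))

    agree-rel : ∀ {i j} R {xs ys} → Agree (α i) (α j) xs ys → rel (A i) R xs → rel (A j) R ys
    agree-rel {i} {j} R rs h with directed i j
    ... | k , p , q with move-both p q rs
    ...   | zs , ss , ts = from (elementary⇒rel (≼⇒⊆ q) (elementary q) R ts)
                             (to (elementary⇒rel (≼⇒⊆ p) (elementary p) R ss) h)

    -- Directedness is used once for each coordinate; `i₀` provides a member of the family for the
    -- empty tuple.
    gather : {X : Set} (f : X → V) → (∀ x → ∃[ i ] f x ∈ dom (A i)) → (xs : Vec X n) →
             ∃[ k ] Σ[ ys ∈ Vec (Carrier (A k)) n ] Agree f (α k) xs ys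
    gather f cover [] = i₀ , [] , []
    gather f cover (x ∷ xs) with cover x | gather f cover xs
    ... | i , y , e | j , ys , rs with directed i j
    ...   | k , p , q with move p y | choose (move q) ys
    ...     | z , e′ | zs , ss = k , z ∷ zs ,
      ≐-trans (f x) (α i y) (α k z) (≐-sym (α i y) (f x) e) e′ ∷ agree-trans f (α j) (α k) rs ss

    module _ (U : Structure L) (isUnion : IsUnion A U) where
      open IsUnion isUnion
      private
        υ = name (dom U)

      union-cover : ∀ x → ∃[ i ] υ x ∈ dom (A i)
      union-cover x = to (union-dom (υ x)) (x , ≐-refl (υ x))

      union-⊆ : ∀ i → dom (A i) ⊆ dom U
      union-⊆ i v x∈ = from (union-dom v) (i , x∈)

      union-embeds : ∀ i → Embeds (A i) U (λ x y → α i x ≐ υ y)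
      union-embeds i = record
        { total     = ∈⇒image (dom (A i)) (dom U) (union-⊆ i)
        ; related-≈ = λ {x} {x′} {y} {y′} r r′ → mk⇔
            (λ e → ≐-trans (υ y) (α i x) (υ y′) (≐-sym (α i x) (υ y) r) (≐-trans (α i x) (α i x′) (υ y′) e r′))
            (λ e → ≐-trans (α i x) (υ y) (α i x′) r
                     (≐-trans (υ y) (υ y′) (α i x′) e (≐-sym (α i x′) (υ y′) r′)))
        ; related-fun = λ f {xs} {ys} rs →
            let (zs , ss , e) = from (union-fun f (map (α i) xs) (α i (fun (A i) f xs)))
                                  (i , xs , names (dom (A i)) xs , ≐-refl (α i (fun (A i) f xs)))
                ts = agree-trans υ id υ ss
                       (agree-trans id (α i) υ (agree-sym (α i) id (names (dom (A i)) xs)) rs)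
            in ≐-trans (α i (fun (A i) f xs)) (υ (fun U f zs)) (υ (fun U f ys))
                 (≐-sym (υ (fun U f zs)) (α i (fun (A i) f xs)) e) (fun-cong U f ts)
        ; related-rel = λ R {xs} {ys} rs → mk⇔
            (λ h → let (zs , ss , h′) = from (union-rel R (map (α i) xs)) (i , xs , names (dom (A i)) xs , h) in
              rel-cong U R (agree-trans υ id υ ss
                (agree-trans id (α i) υ (agree-sym (α i) id (names (dom (A i)) xs)) rs)) h′)
            (λ h → let (j , zs , ss , h′) = to (union-rel R (map υ ys)) (ys , names (dom U) ys , h) in
              agree-rel R (agree-trans (α j) id (α i) ss
                (agree-trans id υ (α i) (agree-sym υ id (names (dom U) ys)) (agree-sym (α i) υ rs))) h′)
        }

      -- Stated for an arbitrary union, so as to cover both the given limit stages of a chain and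
      -- the union constructed below.
      ≼-union : ∀ i → A i ≼ U
      ≼-union i = elementary⇒≼ (union-⊆ i) λ φ φ∈ xs ys →
        tarskiVaught A U (λ i x y → α i x ≐ υ y) union-embeds witness φ φ∈ i
        where
        witness : ∀ {n} {φ : Formula L Λ (suc n)} → φ ∈ᶠ 𝔸 →
                  (∀ i → Preserved (A i) U (λ x y → α i x ≐ υ y) φ) →
                  ∀ i {xs ys} → Agree (α i) υ xs ys → ∀ y → U ⊨ φ [ y ∷ ys ] →
                  ∃[ x ] A i ⊨ φ [ x ∷ xs ]
        witness {φ = φ} φ∈ ih i {xs} {ys} rs y h =
          -- The witness `y` comes from some `A j`. In a common extension `A k` the induction
          -- hypothesis makes `ex φ` true, and `A i ≼ A k` brings this down to `A i`.
          let (j , x , e) = union-cover y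
              (k , p , q) = directed i j
              (z , e′)    = move q x
              (zs , ss)   = choose (move p) xs
              zs≐ys = agree-trans (α k) (α i) υ (agree-sym (α i) (α k) ss) rs
              z≐y = ≐-trans (α k z) (α j x) (υ y) (≐-sym (α j x) (α k z) e′) e
          in from (elementary p (ex φ) (ex∈ φ∈) xs zs ss) (z , from (ih k (z≐y ∷ zs≐ys)) h)

      -- A finite tuple of `U` already lies in one `A k`, which is elementary in both `U` and `M`.
      union-least : ∀ {M} → (∀ i → A i ≼ M) → U ≼ M
      union-least {M} below = elementary⇒≼
        (λ v v∈U → let (i , v∈) = to (union-dom v) v∈U in ≼⇒⊆ (below i) v v∈)
        λ φ φ∈ us ys rs →
          let (k , xs , ss) = gather υ union-cover us
              ts = agree-sym υ (α k) ss
          in elementary (below k) φ φ∈ xs ys (agree-trans (α k) υ (name (dom M)) ts rs)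
             ⇔-∘ ⇔-sym (elementary (≼-union k) φ φ∈ xs us ts)

    ⋃Carrier : Set
    ⋃Carrier = ∃[ i ] Carrier (A i)

    υ : ⋃Carrier → V
    υ (i , x) = α i x

    υ-cover : ∀ u → ∃[ i ] υ u ∈ dom (A i)
    υ-cover (i , x) = i , x , ≐-refl (α i x)

    -- Computed in a member that contains all arguments; by `⋃fun-≐` the name of the value does not
    -- depend on that member.
    ⋃fun : ∀ f → Vec ⋃Carrier (arity L f) → ⋃Carrier
    ⋃fun f us = let (k , ys , _) = gather υ υ-cover us in k , fun (A k) f ys

    ⋃fun-≐ : ∀ f {us} i {xs} → Agree υ (α i) us xs → υ (⋃fun f us) ≐ α i (fun (A i) f xs)
    ⋃fun-≐ f {us} i rs = let (k , ys , ss) = gather υ υ-cover us in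
      agree-fun f (agree-trans (α k) υ (α i) (agree-sym υ (α k) ss) rs)

    ⋃ : Structure L
    ⋃ = record
      { dom      = sup ⋃Carrier υ
      ; fun      = ⋃fun
      ; fun-cong = λ f {us} {us′} rs → let (k , ys , ss) = gather υ υ-cover us′ in
          ⋃fun-≐ f {us} k (agree-trans υ υ (α k) rs ss)
      ; rel      = λ R us → ∃[ i ] ∃[ xs ] Agree υ (α i) us xs × rel (A i) R xs
      ; rel-cong = λ R rs (i , xs , ss , h) →
          i , xs , agree-trans υ υ (α i) (agree-sym υ υ rs) ss , h
      }

    ⋃-isUnion : IsUnion A ⋃
    ⋃-isUnion = record
      { union-dom = λ v → mk⇔ (λ ((i , x) , e) → i , x , e) (λ (i , x , e) → (i , x) , e)
      ; union-fun = λ f vs w → mk⇔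
          (λ (us , us≐vs , e) → let (k , ys , ss) = gather υ υ-cover us in
            k , ys , agree-trans (α k) υ id (agree-sym υ (α k) ss) us≐vs , e)
          (λ (i , xs , xs≐vs , e) → map (i ,_) xs , map-pointwise xs≐vs ,
            ≐-trans (υ (⋃fun f (map (i ,_) xs))) (α i (fun (A i) f xs)) w
              (⋃fun-≐ f {map (i ,_) xs} i (tagged i xs)) e)
      ; union-rel = λ R vs → mk⇔
          (λ (us , us≐vs , i , xs , ss , h) →
            i , xs , agree-trans (α i) υ id (agree-sym υ (α i) ss) us≐vs , h)
          (λ (i , xs , xs≐vs , h) → map (i ,_) xs , map-pointwise xs≐vs , i , xs , tagged i xs , h)
      }
      where
      tagged : ∀ i (xs : Vec (Carrier (A i)) n) → Agree υ (α i) (map (i ,_) xs) xs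
      tagged i xs = map-pointwise (Pointwise.refl (λ {x} → ≐-refl (α i x)))

  -- The Skolem hull inside B: a leaf denotes an element of B or a formula of 𝔸, and
  -- node (leaf φ) t is the value of a Skolem function for φ at the tuple coded by t.
  module SkolemHull (B : Structure L) (default : Carrier B) {X : Set} (decode : X → Carrier B ⊎ Σ ℕ Code)
    (covers : ∀ {n} {φ : Formula L Λ n} → φ ∈ᶠ 𝔸 → ∃[ x ] Σ[ c ∈ Code n ] decode x ≡ inj₂ (n , c) × formula c ≋ φ)
    where
    private
      β = name (dom B)

    -- Excluded middle for the Σ-type returns a witness along with its decision. The function acts
    -- on indices and may differ at tuples with the same names.
    skolem : ∀ {n} → Code (suc n) → Vec (Carrier B) n → Carrier B
    skolem c xs with em₀ {∃[ x ] B ⊨ formula c [ x ∷ xs ]}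
    ... | yes (x , _) = x
    ... | no _        = default

    skolem-⊨ : ∀ {n} (c : Code (suc n)) xs {x} → B ⊨ formula c [ x ∷ xs ] → B ⊨ formula c [ skolem c xs ∷ xs ]
    skolem-⊨ c xs h with em₀ {∃[ x ] B ⊨ formula c [ x ∷ xs ]}
    ... | yes (_ , h′) = h′
    ... | no none      = contradiction (_ , h) none

    -- Tuples of every length are passed in, since decoding alone reveals how many parameters the
    -- formula takes. Elements of `B` and sentences have no variable to be witnessed and give the
    -- default.
    apply : Carrier B ⊎ Σ ℕ Code → (∀ n → Vec (Carrier B) n) → Carrier B
    apply (inj₂ (suc n , c)) xs = skolem c (xs n)
    apply _                  xs = default

    mutual
      -- Ill-formed trees get the default, so every tree denotes an element of `B` and `Tree X` can
      -- index the universe of the hull.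
      value : Tree X → Carrier B
      value (leaf x)            = [ id , (λ _ → default) ]′ (decode x)
      value (node (leaf x) t)   = apply (decode x) (λ n → values n t)
      value (node (node _ _) _) = default

      values : ∀ n → Tree X → Vec (Carrier B) n
      values zero    _          = []
      values (suc n) (leaf _)   = replicate _ default
      values (suc n) (node t u) = value t ∷ values n u

    -- An end marker whose label is irrelevant, because `values zero` ignores its tree.
    nil : Tree X
    nil = leaf (proj₁ (covers (equ∈ {n = 1} (var zero) (var zero))))

    tuple : ∀ {n} → Vec (Tree X) n → Tree X
    tuple []       = nil
    tuple (t ∷ ts) = node t (tuple ts)

    values-tuple : ∀ {n} (ts : Vec (Tree X) n) → values n (tuple ts) ≡ map value ts
    values-tuple []       = refl
    values-tuple (t ∷ ts) = cong (value t ∷_) (values-tuple ts)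

    witness : ∀ {n} {φ : Formula L Λ (suc n)} → φ ∈ᶠ 𝔸 → ∀ (ts : Vec (Tree X) n) {y} →
              B ⊨ φ [ y ∷ map value ts ] → ∃[ t ] B ⊨ φ [ value t ∷ map value ts ]
    witness {n} {φ} φ∈ ts {y} h with covers φ∈
    ... | x , c , e , c≋φ = node (leaf x) (tuple ts) , to (⊨-≋ B (formula c) φ c≋φ _)
      (≡.subst (λ z → B ⊨ formula c [ z ∷ map value ts ]) (≡.sym value≡)
        (skolem-⊨ c (map value ts) (from (⊨-≋ B (formula c) φ c≋φ _) h)))
      where
      value≡ : value (node (leaf x) (tuple ts)) ≡ skolem c (map value ts)
      value≡ = ≡.trans (cong (λ d → apply d (λ n → values n (tuple ts))) e) (cong (skolem c) (values-tuple ts))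

    -- The Skolem function of the graph formula of `f` gives the value of `f`, up to equality of
    -- names.
    closed : ∀ f (ts : Vec (Tree X) (arity L f)) → ∃[ t ] β (value t) ≐ β (fun B f (map value ts))
    closed f ts =
      let (t , h) = witness {φ = graphFormula f} (equ∈ _ _) ts
            (≡.subst id (≡.sym (graphFormula-⊨ {Λ = Λ} B f (fun B f (map value ts)) (map value ts)))
              (≐-refl (β (fun B f (map value ts)))))
      in t , ≡.subst id (graphFormula-⊨ {Λ = Λ} B f (value t) (map value ts)) h

    hull : Structure L
    hull = record
      { dom      = sup (Tree X) (β ∘ value)
      ; fun      = λ f ts → proj₁ (closed f ts)
      ; fun-cong = λ f {ts} {us} rs →
          let (t , e) = closed f ts; (u , e′) = closed f us in
          ≐-trans (β (value t)) (β (fun B f (map value ts))) (β (value u)) e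
            (≐-trans (β (fun B f (map value ts))) (β (fun B f (map value us))) (β (value u))
              (fun-cong B f (Pointwise.map⁺ id rs)) (≐-sym (β (value u)) (β (fun B f (map value us))) e′))
      ; rel      = λ R ts → rel B R (map value ts)
      ; rel-cong = λ R rs → rel-cong B R (Pointwise.map⁺ id rs)
      }

    hull-embeds : Embeds hull B (λ t y → β (value t) ≐ β y)
    hull-embeds = record
      { total     = λ t → value t , ≐-refl (β (value t))
      ; related-≈ = λ {t} {t′} {y} {y′} r r′ → mk⇔
          (λ e → ≐-trans (β y) (β (value t)) (β y′) (≐-sym (β (value t)) (β y) r)
                   (≐-trans (β (value t)) (β (value t′)) (β y′) e r′))
          (λ e → ≐-trans (β (value t)) (β y) (β (value t′)) r
                   (≐-trans (β y) (β y′) (β (value t′)) e (≐-sym (β (value t′)) (β y′) r′)))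
      ; related-fun = λ f {ts} {ys} rs → let (t , e) = closed f ts in
          ≐-trans (β (value t)) (β (fun B f (map value ts))) (β (fun B f ys)) e
            (fun-cong B f (map-pointwise rs))
      ; related-rel = λ R rs → mk⇔ (rel-cong B R (map-pointwise rs))
          (rel-cong B R (agree-sym β β (map-pointwise rs)))
      }

    hull-≼ : hull ≼ B
    hull-≼ = elementary⇒≼ (image⇒⊆ (dom hull) (dom B) (Embeds.total hull-embeds)) λ φ φ∈ ts ys →
      tarskiVaught {I = ⊤} (λ _ → hull) B (λ _ t y → β (value t) ≐ β y) (λ _ → hull-embeds)
        (λ {_} {φ} φ∈ ih _ {ts} {ys} rs y h →
          -- The tuple `ys` only shares its names with the values of `ts`; reflexivity of `≼` on `B`
          -- exchanges the two tuples.
          let same = map-pointwise rs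
              same′ = agree-sym β β same
              (t , h′) = witness φ∈ ts (to (elementary (≼-refl B) φ φ∈ (y ∷ ys) (y ∷ map value ts)
                                              (≐-refl (β y) ∷ same′)) h)
          in t , from (ih tt (≐-refl (β (value t)) ∷ pointwise-map ts (λ t → ≐-refl (β (value t))))) h′)
        φ φ∈ tt

-- Chains indexed by ordinals

module _ {L : Signature} {Λ : Setoid 0ℓ 0ℓ} (em₀ : ExcludedMiddle 0ℓ) (𝔸 : Fragment L Λ)
         (δ : Ordinal) (A : Ordinal.Index δ → Structure L) where
  open Ordinal δ
  open IsStrictTotalOrder isStrictTotalOrder using (compare)
  open ModelTheory em₀ 𝔸

  -- The predicate `P` allows both an initial segment, for limit stages, and the whole index set,
  -- for the union of the chain.
  Increasing : (Index → Set) → Set₁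
  Increasing P = ∀ {α β} → P α → P β → α < β → A α ≼ A β

  increasing⇒directed : ∀ {P} → Increasing P → (i j : Σ Index P) →
                        Σ[ k ∈ Σ Index P ] A (proj₁ i) ≼ A (proj₁ k) × A (proj₁ j) ≼ A (proj₁ k)
  increasing⇒directed inc (α , a) (β , b) with compare α β
  ... | tri< α<β _ _  = (β , b) , inc a b α<β , ≼-refl (A β)
  ... | tri≈ _ refl _ = (α , a) , ≼-refl (A α) , ≼-refl (A α)
  ... | tri> _ _ β<α  = (α , a) , ≼-refl (A α) , inc b a β<α

  -- Well-founded induction on `β`. If `β` follows some `ζ`, then `α` is at most `ζ`. Otherwise `β`
  -- is a limit, being above `α`, and `A β` is the union of the earlier members, which are directed
  -- by the induction hypothesis.
  chain-increasing :
    (∀ α β → IsNext α β → A α ≼ A β) →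
    (∀ ξ → IsLimit ξ → IsUnion {I = ∃[ ζ ] ζ < ξ} (λ (ζ , _) → A ζ) (A ξ)) →
    ∀ {α β} → α < β → A α ≼ A β
  chain-increasing successor limit {β = β} α<β = go β (wellFounded β) α<β
    where
    go : ∀ β → Acc _<_ β → ∀ {α} → α < β → A α ≼ A β
    go β (acc rs) {α} α<β with em₀ {∃[ ζ ] IsNext ζ β}
    ... | no none = DirectedUnion.≼-union (λ (ζ , _) → A ζ) (α , α<β)
      (increasing⇒directed λ {_} {ζ} _ ζ<β → go ζ (rs ζ<β)) (A β)
      (limit β ((α , α<β) , λ ζ next → none (ζ , next))) (α , α<β)
    ... | yes (ζ , next@(ζ<β , least)) with compare α ζ
    ...   | tri< α<ζ _ _  = ≼-trans (go ζ (rs ζ<β) α<ζ) (successor ζ β next)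
    ...   | tri≈ _ refl _ = successor α β next
    ...   | tri> _ _ ζ<α  = contradiction α<β (least α ζ<α)

-- The class of cotorsionfree groups

module Main (em : ExcludedMiddle 1ℓ) (ac : AxiomOfChoice) {Λ : Setoid 0ℓ 0ℓ}
            (ψ : Sentence groupSignature Λ) (K⇔ψ : ∀ G → K G ⇔ G ⊨ ψ)
            (𝔸 : Fragment groupSignature Λ) (ψ∈𝔸 : ψ ∈ᶠ 𝔸) where
  open Fragment 𝔸 using (Code; formula; equ∈)
  open Classical em ac using (em₀; tree-bound; quotient-bound; module Representatives)
  open ModelTheory em₀ 𝔸
  open ElementarySubstructure

  K-≼ : ∀ {M N} → M ≼ N → K M ⇔ K N
  K-≼ {M} {N} p = ⇔-sym (K⇔ψ N) ⇔-∘ (elementary p ψ ψ∈𝔸 [] [] [] ⇔-∘ K⇔ψ M)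

  lsNumber : IsLSNumber K (λ G H → G ≺[ 𝔸 ] H) ∣ 𝔸 ∣
  lsNumber a B B∈K a⊆B = hull , hull∈K , a⊆hull , (hull∈K , B∈K , hull-≼) ,
    quotient-bound ⟪ dom hull ⟫ (tree-bound X infinite)
    where
    X : Setoid 0ℓ 0ℓ
    X = ⟪ a ⟫ ⊎ₛ ∣ 𝔸 ∣
    open Representatives X using (Rep; rep; rep-≈; toRep)

    infinite : ≡.setoid ℕ ≤ᶜ X
    infinite = record
      -- The formula `0 = 0` counted once for each number of free variables: these are distinct
      -- members of the fragment, so `X` is infinite even when `a` is empty.
      { to        = λ n → inj₂ (n , proj₁ (equ∈ {n = n} (app zero []) (app zero [])))
      ; cong      = λ { refl → Setoid.refl X }
      ; injective = λ { (inj₂ (e , _)) → e }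
      }

    decode : Rep → Carrier B ⊎ Σ ℕ Code
    decode (inj₁ x , _) = inj₁ (proj₁ (∈⇒image a (dom B) a⊆B x))
    decode (inj₂ c , _) = inj₂ c

    -- Passing to representatives may replace the code of `φ`, but only by a code in the same number
    -- of variables for an identical formula in the sense of `≋`.
    covers : ∀ {n} {φ : Formula groupSignature Λ n} → φ ∈ᶠ 𝔸 →
             ∃[ x ] Σ[ c ∈ Code n ] decode x ≡ inj₂ (n , c) × formula c ≋ φ
    covers {n} {φ} (c , c≋φ) = found (toRep (inj₂ (n , c))) (rep-≈ (inj₂ (n , c)))
      where
      found : (x : Rep) → Setoid._≈_ X (inj₂ (n , c)) (proj₁ x) →
              ∃[ x ] Σ[ c ∈ Code n ] decode x ≡ inj₂ (n , c) × formula c ≋ φ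
      found x@(inj₂ (_ , c′) , _) (inj₂ (refl , c≋c′)) =
        x , c′ , refl , ≋-trans (formula c′) (formula c) φ (≋-sym (formula c) (formula c′) c≋c′) c≋φ

    open SkolemHull B (0# B) decode covers using (hull; hull-≼)

    hull∈K : K hull
    hull∈K = from (K-≼ hull-≼) B∈K

    a⊆hull : a ⊆ dom hull
    a⊆hull = image⇒⊆ a (dom hull) λ x → found x (toRep (inj₁ x)) (rep-≈ (inj₁ x))
      where
      found : ∀ x (y : Rep) → Setoid._≈_ X (inj₁ x) (proj₁ y) → ∃[ t ] name a x ≐ name (dom hull) t
      found x y@(inj₁ x′ , _) (inj₁ x≐x′) = leaf y ,
        ≐-trans (name a x) (name a x′) (name (dom hull) (leaf y)) x≐x′ (proj₂ (∈⇒image a (dom B) a⊆B x′))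

  isAEC : IsAEC K (λ G H → G ≺[ 𝔸 ] H)
  isAEC = record
    { onClass         = λ (M∈K , N∈K , _) → M∈K , N∈K
    ; iso-class       = iso-K
    ; iso-order       = λ { f₀ f₁ (M₀∈K , M₁∈K , p) ext →
                            iso-K f₀ M₀∈K , iso-K f₁ M₁∈K , ≼-isomorphism f₀ f₁ p ext }
    ; reflexive       = λ {M} M∈K → M∈K , M∈K , ≼-refl M
    ; transitive      = λ (M∈K , _ , p) (_ , P∈K , q) → M∈K , P∈K , ≼-trans p q
    ; antisymmetric   = λ (_ , _ , p) (_ , _ , q) → antisym (isSubstructure p) (isSubstructure q)
    ; substructure    = λ (_ , _ , p) → isSubstructure p
    ; chain           = chain
    ; coherence       = λ A∈K B∈K _ (_ , _ , p) (_ , _ , q) sub → A∈K , B∈K , ≼-coherent p q sub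
    ; löwenheimSkolem = ∣ 𝔸 ∣ , lsNumber
    }
    where
    iso-K : ∀ {M N} → Isomorphism M N → K M → K N
    iso-K {M} {N} f M∈K = from (K⇔ψ N) (to (isomorphism-⊨ f ψ ψ∈𝔸 []) (to (K⇔ψ M) M∈K))

    antisym : ∀ {M N : Structure groupSignature} → Substructure M N → Substructure N M → SameStructure M N
    antisym p q = record
      { same-dom = λ v → mk⇔ (P.sub-dom v) (Q.sub-dom v)
      ; same-fun = λ f vs w → mk⇔ (P.sub-fun f vs w) (Q.sub-fun f vs w)
      ; same-rel = λ ()
      }
      where
      module P = Substructure p
      module Q = Substructure q

    chain : ∀ (δ : Ordinal) (A : Ordinal.Index δ → Structure groupSignature) →
            Ordinal.Index δ → IsContinuousChain K (λ G H → G ≺[ 𝔸 ] H) δ A →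
            Σ[ U ∈ Structure groupSignature ] IsUnion A U × K U × (∀ β → A β ≺[ 𝔸 ] U) ×
              (∀ M → K M → (∀ β → A β ≺[ 𝔸 ] M) → U ≺[ 𝔸 ] M)
    chain δ A α₀ isChain = ⋃ , ⋃-isUnion , ⋃∈K ,
      (λ β → inClass β , ⋃∈K , ≼-union ⋃ ⋃-isUnion β) ,
      (λ M M∈K below → ⋃∈K , M∈K , union-least ⋃ ⋃-isUnion (λ β → proj₂ (proj₂ (below β))))
      where
      open IsContinuousChain isChain

      directed : ∀ α β → ∃[ γ ] A α ≼ A γ × A β ≼ A γ
      directed α β =
        let ((γ , _) , p , q) = increasing⇒directed em₀ 𝔸 δ A {P = λ _ → ⊤}
              (λ _ _ → chain-increasing em₀ 𝔸 δ A
                         (λ α β next → proj₂ (proj₂ (increasing α β next))) continuous)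
              (α , tt) (β , tt)
        in γ , p , q

      open DirectedUnion A α₀ directed

      -- The chain has a member `A α₀` because its length is nonzero, and this member is elementary
      -- in the union.
      ⋃∈K : K ⋃
      ⋃∈K = to (K-≼ (≼-union ⋃ ⋃-isUnion α₀)) (inClass α₀)

theorem2p1 : ExcludedMiddle 1ℓ → AxiomOfChoice →
    (Λ : Setoid 0ℓ 0ℓ) → IsSuccessorCardinal 2^ℵ₀ Λ →
    (ψ : Sentence groupSignature Λ) → (∀ G → K G ⇔ G ⊨ ψ) →
    (𝔸 : Fragment groupSignature Λ) → ψ ∈ᶠ 𝔸 →
    IsAEC K (λ G H → G ≺[ 𝔸 ] H) × IsLSNumber K (λ G H → G ≺[ 𝔸 ] H) ∣ 𝔸 ∣
theorem2p1 em ac Λ _ ψ K⇔ψ 𝔸 ψ∈𝔸 = isAEC , lsNumber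
  where
  open Main em ac ψ K⇔ψ 𝔸 ψ∈𝔸
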